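{- Let $n\ge 1$ and let $\Phi_n(x)$ be the $n$-th cyclotomic polynomial. Then: (i) $2\Phi_n'''(1)$ is divisible by $\phi(n)-2$; in particular, if $\phi(n)$ is divisible by $4$, then $\Phi_n'''(1)$ is divisible by $\phi(n)-2$. (ii) For every integer $k\ge 2$, $\Phi_n^{(2k+1)}(1)$ is divisible by $\phi(n)-2k$.
   Context: $\Phi_n(x)\in\mathbb{Z}[x]$ is the $n$-th cyclotomic polynomial, of degree $\phi(n)$ (Euler's totient); $\Phi_n^{(m)}$ denotes its $m$-th derivative. Divisibility is in $\mathbb{Z}$; an integer is divisible by $0$ only if it equals $0$. -}

module Defs where

open import Data.Nat as ℕ using (ℕ; zero; suc; _≤ᵇ_)
open import Data.Nat.Divisibility using (_∣?_)
open import Data.Nat.GCD using (gcd)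
open import Data.Integer as ℤ using (ℤ; +_; -[1+_])
open import Data.List using (List; []; _∷_; map; reverse; length; filter; applyUpTo; replicate; _++_; foldr; sum; [_])
open import Data.Bool using (if_then_else_)
open import Relation.Binary.PropositionalEquality using (_≡_; refl)

-- Polynomials over ℤ as coefficient lists, lowest degree first:
-- c₀ ∷ c₁ ∷ … ∷ c_d ∷ []  represents  c₀ + c₁ x + … + c_d x^d.
Poly : Set
Poly = List ℤ

infixl 6 _+P_
infixl 7 _*P_

_+P_ : Poly → Poly → Poly
[]       +P q        = q
(a ∷ p)  +P []       = a ∷ p
(a ∷ p)  +P (b ∷ q)  = (a ℤ.+ b) ∷ (p +P q)

_*P_ : Poly → Poly → Poly
[]      *P q = []
(a ∷ p) *P q = map (a ℤ.*_) q +P ((+ 0) ∷ (p *P q))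

xPowMinusOne : ℕ → Poly
xPowMinusOne m = (replicate m (+ 0) ++ [ + 1 ]) +P [ -[1+ 0 ] ]

-- Exact division by a MONIC polynomial (long division), on coefficient
-- lists given highest degree first.  Returns the quotient (highest first).
private
  subPref : List ℤ → List ℤ → List ℤ
  subPref (x ∷ xs) (y ∷ ys) = (x ℤ.- y) ∷ subPref xs ys
  subPref xs       []       = xs
  subPref []       (y ∷ ys) = []

  tailL : List ℤ → List ℤ
  tailL []       = []
  tailL (_ ∷ xs) = xs

  divHF : ℕ → List ℤ → List ℤ → List ℤ
  divHF zero    B A        = []
  divHF (suc f) B []       = []
  divHF (suc f) B (a ∷ as) =
    if length B ≤ᵇ suc (length as)
    then a ∷ divHF f B (tailL (subPref (a ∷ as) (map (a ℤ.*_) B)))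
    else []

divMonic : Poly → Poly → Poly
divMonic A B = reverse (divHF (length A) (reverse B) (reverse A))

-- Cyclotomic polynomials, defined by  x^n - 1 = ∏_{d ∣ n} Φ_d ,
-- i.e.  Φ_n = (x^n - 1) / ∏_{d ∣ n, d < n} Φ_d   (exact division by a monic polynomial).
-- cycloTable n = [Φ_1 , … , Φ_n].
private
  lookupΦ : List Poly → ℕ → Poly
  lookupΦ []       _             = [ + 1 ]
  lookupΦ (p ∷ ps) zero          = [ + 1 ]
  lookupΦ (p ∷ ps) (suc zero)    = p
  lookupΦ (p ∷ ps) (suc (suc d)) = lookupΦ ps (suc d)

  properDivisors : ℕ → List ℕ
  properDivisors m = filter (_∣? m) (applyUpTo suc (m ℕ.∸ 1))

  nextΦ : ℕ → List Poly → Poly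
  nextΦ m tab = divMonic (xPowMinusOne m)
                  (foldr (λ d acc → lookupΦ tab d *P acc) [ + 1 ] (properDivisors m))

cycloTable : ℕ → List Poly
cycloTable zero    = []
cycloTable (suc n) = let t = cycloTable n in t ++ [ nextΦ (suc n) t ]

-- Φ n  is the n-th cyclotomic polynomial for n ≥ 1 (Φ 0 is a junk value).
Φ : ℕ → Poly
Φ zero    = [ + 1 ]
Φ (suc n) = nextΦ (suc n) (cycloTable n)

private
  derivAux : ℕ → Poly → Poly
  derivAux k []       = []
  derivAux k (c ∷ cs) = ((+ k) ℤ.* c) ∷ derivAux (suc k) cs

deriv : Poly → Poly
deriv []       = []
deriv (c ∷ cs) = derivAux 1 cs

derivN : ℕ → Poly → Poly
derivN zero    p = p
derivN (suc m) p = deriv (derivN m p)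

evalAt1 : Poly → ℤ
evalAt1 = foldr ℤ._+_ (+ 0)

ΦDerivAt1 : ℕ → ℕ → ℤ
ΦDerivAt1 n m = evalAt1 (derivN m (Φ n))

φ : ℕ → ℕ
φ n = length (filter (λ k → gcd k n ℕ.≟ 1) (applyUpTo suc n))

private
  _ : Φ 1 ≡ -[1+ 0 ] ∷ + 1 ∷ []
  _ = refl
  _ : Φ 6 ≡ + 1 ∷ -[1+ 0 ] ∷ + 1 ∷ []
  _ = refl
  _ : Φ 12 ≡ + 1 ∷ + 0 ∷ -[1+ 0 ] ∷ + 0 ∷ + 1 ∷ []
  _ = refl
  _ : Φ 9 ≡ + 1 ∷ + 0 ∷ + 0 ∷ + 1 ∷ + 0 ∷ + 0 ∷ + 1 ∷ []
  _ = refl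
  _ : φ 12 ≡ 4
  _ = refl
  _ : φ 1 ≡ 1
  _ = refl
  _ : ΦDerivAt1 5 3 ≡ + 30
  _ = refl

{-# OPTIONS --safe #-}
-- Φₙ is palindromic of degree d = φ(n) for n ≥ 2, and Φₙ^(m)(1) = Σⱼ cⱼ j(j−1)⋯(j−m+1).  For
-- m = 2k+1 the falling factorials of j and d−j are opposite modulo d−2k, so opposite coefficients
-- cancel; only the middle term j = d/2 (d even) is left, where a parity argument is needed.
--
-- Palindromicity requires that the long division defining Φₙ be exact.  At each integer x ≥ 2 the
-- values Φ_a(x), Φ_b(x) for distinct proper divisors a, b of n generate an ideal containing n,
-- because (x^b−1)/(x^g−1) ≡ b/g modulo x^g−1 for g = gcd(a,b).  Hence the product of the values
-- over the proper divisors divides nᵗ(xⁿ−1) with t independent of x.  The remainder of the division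
-- is of smaller degree than the divisor, so this divisibility at large x forces it to vanish.
module Submission where

open import Defs

-- The factor nᵗ cannot simply be dropped: over the integers the values Φ_a(x), Φ_b(x) at distinct
-- indices may share primes, as Φ₁(3) = 2 and Φ₂(3) = 4 do. Being independent of x, it only alters a
-- constant in the growth comparison that kills the remainder. Working with values in place of
-- polynomial ideals keeps each step an identity in ℤ, and coefficient lists of equal length are
-- recovered from their values at large integers.
--
-- That the degree is φ(n) rests on Gauss's identity: φ(d) summed over the divisors d of n gives n.
-- Φ₁ = x - 1 is antipalindromic, so n = 1 is treated apart.
--
-- For d = 2e the middle weight is e(e - 1)...(e - 2k), while d - 2k = 2(e - k). Cancelling e - k
-- leaves a product that ought to be even. For k ≥ 2 it contains two consecutive integers; for k = 1
-- it is e(e - 2), even only for even e. This is the origin of the 2 in (i) and of the condition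
-- that 4 divides φ(n).

-- Gauss's divisor sum for Euler's totient

module TotientSum where
  open import Data.Nat
  open import Data.Nat.Properties
  open import Data.Nat.Divisibility
  open import Data.Nat.GCD using (gcd; gcd[m,n]∣m; gcd[m,n]∣n; c*gcd[m,n]≡gcd[cm,cn])
  open import Algebra.Properties.CommutativeSemigroup +-commutativeSemigroup using (interchange)
  open import Data.List using (length; filter; applyUpTo; [_]; _∷ʳ_)
  open import Data.List.Properties using (applyUpTo-∷ʳ; filter-++; length-++)
  open import Data.Bool using (if_then_else_)
  open import Data.Empty using (⊥-elim)
  open import Function using (_∘_; _⇔_; mk⇔; Equivalence)
  open import Relation.Nullary using (Dec; does; yes; no; ¬_)
  open import Relation.Unary using (Decidable)
  open import Relation.Binary.PropositionalEquality hiding ([_])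
  open ≡-Reasoning

  -- The summation index runs from 1 to n.
  ∑ : ℕ → (ℕ → ℕ) → ℕ
  ∑ zero    f = 0
  ∑ (suc n) f = ∑ n f + f (suc n)

  ⟦_⟧ : ∀ {P : Set} → Dec P → ℕ
  ⟦ d ⟧ = if does d then 1 else 0

  ⟦⟧-true : ∀ {P : Set} (d : Dec P) → P → ⟦ d ⟧ ≡ 1
  ⟦⟧-true (yes _) _ = refl
  ⟦⟧-true (no ¬p) p = ⊥-elim (¬p p)

  ⟦⟧-false : ∀ {P : Set} (d : Dec P) → ¬ P → ⟦ d ⟧ ≡ 0
  ⟦⟧-false (yes p) ¬p = ⊥-elim (¬p p)
  ⟦⟧-false (no _)  _  = refl

  ⟦⟧-cong : ∀ {P Q : Set} (d : Dec P) (e : Dec Q) → P ⇔ Q → ⟦ d ⟧ ≡ ⟦ e ⟧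
  ⟦⟧-cong (yes p) e eq = sym (⟦⟧-true e (Equivalence.to eq p))
  ⟦⟧-cong (no ¬p) e eq = sym (⟦⟧-false e (¬p ∘ Equivalence.from eq))

  ∑-cong : ∀ n {f g} → (∀ i → 1 ≤ i → i ≤ n → f i ≡ g i) → ∑ n f ≡ ∑ n g
  ∑-cong zero    h = refl
  ∑-cong (suc n) h = cong₂ _+_ (∑-cong n λ i 1≤i i≤n → h i 1≤i (m≤n⇒m≤1+n i≤n)) (h (suc n) (s≤s z≤n) ≤-refl)

  ∑-const : ∀ n c → ∑ n (λ _ → c) ≡ n * c
  ∑-const zero    c = refl
  ∑-const (suc n) c = trans (cong (_+ c) (∑-const n c)) (+-comm (n * c) c)

  ∑-zero : ∀ n {f} → (∀ i → 1 ≤ i → i ≤ n → f i ≡ 0) → ∑ n f ≡ 0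
  ∑-zero n h = trans (∑-cong n h) (trans (∑-const n 0) (*-zeroʳ n))

  ∑-distrib-+ : ∀ n f g → ∑ n (λ i → f i + g i) ≡ ∑ n f + ∑ n g
  ∑-distrib-+ zero    f g = refl
  ∑-distrib-+ (suc n) f g = trans (cong (_+ (f (suc n) + g (suc n))) (∑-distrib-+ n f g)) (interchange (∑ n f) _ _ _)

  ∑-swap : ∀ m n (f : ℕ → ℕ → ℕ) → ∑ m (λ i → ∑ n (f i)) ≡ ∑ n (λ j → ∑ m (λ i → f i j))
  ∑-swap zero    n f = sym (∑-zero n λ _ _ _ → refl)
  ∑-swap (suc m) n f = trans (cong (_+ ∑ n (f (suc m))) (∑-swap m n f)) (sym (∑-distrib-+ n _ _))

  ∑-single : ∀ n {f} j → 1 ≤ j → j ≤ n → f j ≡ 1 → (∀ i → i ≢ j → f i ≡ 0) → ∑ n f ≡ 1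
  ∑-single zero    j (s≤s _) () _ _
  ∑-single (suc n) j 1≤j j≤n one zer with j ≟ suc n
  ... | yes refl = cong₂ _+_ (∑-zero n λ i _ i≤n → zer i (<⇒≢ (s≤s i≤n))) one
  ... | no  j≢   = cong₂ _+_ (∑-single n j 1≤j (s≤s⁻¹ (≤∧≢⇒< j≤n j≢)) one zer) (zer (suc n) (j≢ ∘ sym))

  ∑-+ : ∀ r m f → ∑ (r + m) f ≡ ∑ m f + ∑ r (λ i → f (i + m))
  ∑-+ zero    m f = sym (+-identityʳ _)
  ∑-+ (suc r) m f = trans (cong (_+ f (suc r + m)) (∑-+ r m f)) (+-assoc (∑ m f) _ _)

  -- Cut the range into `d` blocks of length `g`: in each block only the last index is a multiple of
  -- `g`.
  ∑-multiples : ∀ d g .{{_ : NonZero g}} {f} → (∀ k → ¬ g ∣ k → f k ≡ 0) →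
    ∑ (d * g) f ≡ ∑ d (λ j → f (j * g))
  ∑-multiples zero    g       zer = refl
  ∑-multiples (suc d) (suc g) {f} zer = trans (∑-+ (suc g) (d * suc g) f)
    (cong₂ _+_ (∑-multiples d (suc g) zer) (cong (_+ f (suc d * suc g)) (∑-zero g λ i 1≤i i≤g →
      zer _ λ div → <⇒≱ (s≤s i≤g) (∣⇒≤ {{>-nonZero 1≤i}} (∣m+n∣n⇒∣m {m = i} div (n∣m*n d))))))
    where
    ∣m+n∣n⇒∣m : ∀ {i m n} → i ∣ m + n → i ∣ n → i ∣ m
    ∣m+n∣n⇒∣m {i} {m} {n} h = ∣m+n∣m⇒∣n (subst (i ∣_) (+-comm m n) h)

  length-filter-applyUpTo : ∀ {P : ℕ → Set} (P? : Decidable P) n →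
    length (filter P? (applyUpTo suc n)) ≡ ∑ n (⟦_⟧ ∘ P?)
  length-filter-applyUpTo P? zero    = refl
  length-filter-applyUpTo P? (suc n) = begin
    length (filter P? (applyUpTo suc (suc n)))                       ≡⟨ cong (length ∘ filter P?) (applyUpTo-∷ʳ suc n) ⟨
    length (filter P? (applyUpTo suc n ∷ʳ suc n))                    ≡⟨ cong length (filter-++ P? (applyUpTo suc n) [ suc n ]) ⟩
    _                                                                ≡⟨ length-++ (filter P? (applyUpTo suc n)) ⟩
    length (filter P? (applyUpTo suc n)) + length (filter P? [ suc n ]) ≡⟨ cong₂ _+_ (length-filter-applyUpTo P? n) last ⟩
    ∑ n (⟦_⟧ ∘ P?) + ⟦ P? (suc n) ⟧                                  ∎
    where
    last : length (filter P? [ suc n ]) ≡ ⟦ P? (suc n) ⟧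
    last with P? (suc n)
    ... | yes _ = refl
    ... | no  _ = refl

  φ≡∑ : ∀ n → φ n ≡ ∑ n (λ k → ⟦ gcd k n ≟ 1 ⟧)
  φ≡∑ n = length-filter-applyUpTo (λ k → gcd k n ≟ 1) n

  -- Sort the numbers k ≤ n by the reduced denominator d of k/n.
  ∑φ : ∀ n .{{_ : NonZero n}} → ∑ n (λ d → ⟦ d ∣? n ⟧ * φ d) ≡ n
  ∑φ n = begin
    ∑ n (λ d → ⟦ d ∣? n ⟧ * φ d)                    ≡⟨ ∑-cong n (λ d 1≤d _ → by-denominator d {{>-nonZero 1≤d}}) ⟩
    ∑ n (λ d → ∑ n (λ k → ⟦ gcd k n * d ≟ n ⟧))     ≡⟨ ∑-swap n n _ ⟩
    ∑ n (λ k → ∑ n (λ d → ⟦ gcd k n * d ≟ n ⟧))     ≡⟨ ∑-cong n (λ k _ _ → unique-denominator (gcd k n) (gcd[m,n]∣n k n)) ⟩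
    ∑ n (λ _ → 1)                                   ≡⟨ ∑-const n 1 ⟩
    n * 1                                           ≡⟨ *-identityʳ n ⟩
    n                                               ∎
    where
    unique-denominator : ∀ g → g ∣ n → ∑ n (λ d → ⟦ g * d ≟ n ⟧) ≡ 1
    unique-denominator g (divides q n≡qg) = ∑-single n q
      (n≢0⇒n>0 λ { refl → ≢-nonZero⁻¹ n n≡qg }) (∣⇒≤ (divides g (trans n≡qg (*-comm q g))))
      (⟦⟧-true (g * q ≟ n) gq≡n)
      (λ i i≢q → ⟦⟧-false (g * i ≟ n) λ gi≡n → i≢q (*-cancelˡ-≡ i q g {{g≢0}} (trans gi≡n (sym gq≡n))))
      where
      gq≡n = trans (*-comm g q) (sym n≡qg)
      g≢0 : NonZero g
      g≢0 = ≢-nonZero λ { refl → ≢-nonZero⁻¹ n (trans n≡qg (*-zeroʳ q)) }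

    -- The equation `gcd k n * d ≡ n` says without division that `d` is the reduced denominator of
    -- k/n. If n = q d, it forces k = j q, and then it amounts to j being coprime to `d`.
    by-denominator : ∀ d .{{_ : NonZero d}} → ⟦ d ∣? n ⟧ * φ d ≡ ∑ n (λ k → ⟦ gcd k n * d ≟ n ⟧)
    by-denominator d with d ∣? n
    ... | no  d∤n = sym (∑-zero n λ k _ _ → ⟦⟧-false (gcd k n * d ≟ n) λ eq → d∤n (divides (gcd k n) (sym eq)))
    ... | yes (divides q n≡qd) = trans (+-identityʳ _) (trans (φ≡∑ d) (sym (begin
      ∑ n f                            ≡⟨ cong (λ m → ∑ m f) n≡dq ⟩
      ∑ (d * q) f                      ≡⟨ ∑-multiples d q {{q≢0}} (λ k q∤k → ⟦⟧-false (gcd k n * d ≟ n) λ eq →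
                                            q∤k (subst (_∣ k) (*-cancelʳ-≡ _ q d (trans eq n≡qd)) (gcd[m,n]∣m k n))) ⟩
      ∑ d (λ j → f (j * q))            ≡⟨ ∑-cong d (λ j _ _ → ⟦⟧-cong (gcd (j * q) n * d ≟ n) (gcd j d ≟ 1) (scaled j)) ⟩
      ∑ d (λ j → ⟦ gcd j d ≟ 1 ⟧)      ∎)))
      where
      f : ℕ → ℕ
      f k = ⟦ gcd k n * d ≟ n ⟧
      n≡dq = trans n≡qd (*-comm q d)
      q≢0 : NonZero q
      q≢0 = ≢-nonZero λ { refl → ≢-nonZero⁻¹ n n≡qd }
      gcd-scaled : ∀ j → gcd (j * q) n * d ≡ gcd j d * n
      gcd-scaled j = begin
        gcd (j * q) n * d        ≡⟨ cong₂ (λ a b → gcd a b * d) (*-comm j q) n≡qd ⟩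
        gcd (q * j) (q * d) * d  ≡⟨ cong (_* d) (c*gcd[m,n]≡gcd[cm,cn] q j d) ⟨
        q * gcd j d * d          ≡⟨ cong (_* d) (*-comm q (gcd j d)) ⟩
        gcd j d * q * d          ≡⟨ *-assoc (gcd j d) q d ⟩
        gcd j d * (q * d)        ≡⟨ cong (gcd j d *_) n≡qd ⟨
        gcd j d * n              ∎
      scaled : ∀ j → (gcd (j * q) n * d ≡ n) ⇔ (gcd j d ≡ 1)
      scaled j = mk⇔
        (λ eq → *-cancelʳ-≡ (gcd j d) 1 n (trans (sym (gcd-scaled j)) (trans eq (sym (+-identityʳ n)))))
        (λ eq → trans (gcd-scaled j) (trans (cong (_* n) eq) (+-identityʳ n)))

module Cyclotomic where
  open TotientSum using (∑; ⟦_⟧; ⟦⟧-true; ∑φ)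
  open import Data.Nat as ℕ using (ℕ; zero; suc)
  import Data.Nat.Properties as ℕ
  import Data.Nat.Divisibility as ℕ
  import Data.Nat.Tactic.RingSolver as ℕ
  open import Data.Nat.GCD using (gcd; gcd-GCD; gcd[m,n]∣m; gcd[m,n]∣n; module Bézout)
  open import Data.Nat.Induction using (<-rec)
  open import Data.Nat.ListAction using (sum)
  open import Data.Nat.ListAction.Properties using (sum-++)
  open import Data.Integer hiding (suc)
  open import Data.Integer.DivMod using (_%ℕ_; _/ℕ_; a≡a%ℕn+[a/ℕn]*n; n%ℕd<d)
  open import Data.Integer.Divisibility.Signed
  open import Data.Integer.Properties
  open import Data.Integer.Tactic.RingSolver using (solve-∀)
  open import Algebra.Properties.AbelianGroup +-0-abelianGroup using () renaming (∙-cancelˡ to +-cancelˡ)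
  open import Data.Bool using (true; false; if_then_else_)
  open import Data.Empty using (⊥-elim)
  open import Data.List
    using (List; []; _∷_; [_]; _++_; _∷ʳ_; applyUpTo; filter; foldr; initLast; _∷ʳ′_; length; map; replicate; reverse)
  open import Data.List.Properties hiding (sum-++)
  open import Data.List.Relation.Unary.All using (All; []; _∷_)
  import Data.List.Relation.Unary.All as All using (map)
  import Data.List.Relation.Unary.All.Properties as All
  open import Data.Product using (_×_; _,_; ∃; ∃₂; proj₁; proj₂)
  open import Function using (_∘_)
  open import Relation.Binary.PropositionalEquality hiding ([_])
  open import Relation.Nullary using (Dec; yes; no; ¬_; does)
  open ≡-Reasoning

  -- The helper functions of Defs are private; unification recovers them from the public
  -- definitions once their arguments (and the function applied to them) are generalised by with.
  mutual
    divHF : ℕ → List ℤ → List ℤ → List ℤ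
    divHF = _

    divMonic-eq : ∀ A B → divMonic A B ≡ reverse (divHF (length A) (reverse B) (reverse A))
    divMonic-eq A B with length A | reverse {A = ℤ}
    ... | _ | r with r B | r A
    ... | _ | _ = refl

  mutual
    subPref : List ℤ → List ℤ → List ℤ
    subPref = _

    -- The division also forms the leading difference a - a b and drops it unread. That is harmless
    -- for b = 1, where the difference is zero; hence `divHF-remainder` below fixes the leading
    -- coefficient.
    divHF-eq : ∀ f b B a as → divHF (suc f) (b ∷ B) (a ∷ as) ≡
      (if length (b ∷ B) ℕ.≤ᵇ suc (length as) then a ∷ divHF f (b ∷ B) (subPref as (map (a *_) B)) else [])
    divHF-eq f b B a as with map (a *_) B
    ... | _ = refl

  mutual
    lookupΦ : List Poly → ℕ → Poly
    lookupΦ = _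

    Φ-eq : ∀ n → Φ (suc n) ≡ divMonic (xPowMinusOne (suc n))
      (foldr (λ d acc → lookupΦ (cycloTable n) d *P acc) [ 1ℤ ] (filter (ℕ._∣? suc n) (applyUpTo suc n)))
    Φ-eq n with cycloTable n | _*P_
    ... | _ | _ = refl

  mutual
    derivAux : ℕ → Poly → Poly
    derivAux = _

    deriv-eq : ∀ c p → deriv (c ∷ p) ≡ derivAux 1 p
    deriv-eq c p with 1
    ... | _ = refl

  -- Evaluation of coefficient lists

  ev : Poly → ℤ → ℤ
  ev []      x = 0ℤ
  ev (a ∷ p) x = a + x * ev p x

  -- The coefficient list read highest degree first.
  evʳ : Poly → ℤ → ℤ
  evʳ []      x = 0ℤ
  evʳ (a ∷ p) x = a * x ^ length p + evʳ p x

  ev-+P : ∀ p q x → ev (p +P q) x ≡ ev p x + ev q x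
  ev-+P []      q       x = sym (+-identityˡ _)
  ev-+P (a ∷ p) []      x = sym (+-identityʳ _)
  ev-+P (a ∷ p) (b ∷ q) x =
    trans (cong (λ t → a + b + x * t) (ev-+P p q x)) (regroup a b x (ev p x) (ev q x))
    where
    regroup : ∀ a b x s t → a + b + x * (s + t) ≡ (a + x * s) + (b + x * t)
    regroup = solve-∀

  ev-map-* : ∀ c p x → ev (map (c *_) p) x ≡ c * ev p x
  ev-map-* c []      x = sym (*-zeroʳ c)
  ev-map-* c (a ∷ p) x =
    trans (cong (λ t → c * a + x * t) (ev-map-* c p x)) (regroup c a x (ev p x))
    where
    regroup : ∀ c a x s → c * a + x * (c * s) ≡ c * (a + x * s)
    regroup = solve-∀

  ev-*P : ∀ p q x → ev (p *P q) x ≡ ev p x * ev q x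
  ev-*P []      q x = refl
  ev-*P (a ∷ p) q x = begin
    ev (map (a *_) q +P (0ℤ ∷ p *P q)) x           ≡⟨ ev-+P (map (a *_) q) _ x ⟩
    ev (map (a *_) q) x + (0ℤ + x * ev (p *P q) x) ≡⟨ cong₂ (λ s t → s + (0ℤ + x * t)) (ev-map-* a q x) (ev-*P p q x) ⟩
    a * ev q x + (0ℤ + x * (ev p x * ev q x))      ≡⟨ regroup a x (ev p x) (ev q x) ⟩
    (a + x * ev p x) * ev q x                      ∎
    where
    regroup : ∀ a x s t → a * t + (0ℤ + x * (s * t)) ≡ (a + x * s) * t
    regroup = solve-∀

  ev-∷ʳ : ∀ p a x → ev (p ++ [ a ]) x ≡ ev p x + a * x ^ length p
  ev-∷ʳ []      a x = base a x
    where
    base : ∀ a x → a + x * 0ℤ ≡ 0ℤ + a * 1ℤ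
    base = solve-∀
  ev-∷ʳ (b ∷ p) a x =
    trans (cong (λ t → b + x * t) (ev-∷ʳ p a x)) (regroup a b x (ev p x) (x ^ length p))
    where
    regroup : ∀ a b x s t → b + x * (s + a * t) ≡ b + x * s + a * (x * t)
    regroup = solve-∀

  evʳ-∷ʳ : ∀ p a x → evʳ (p ++ [ a ]) x ≡ a + x * evʳ p x
  evʳ-∷ʳ []      a x = base a x
    where
    base : ∀ a x → a * 1ℤ + 0ℤ ≡ a + x * 0ℤ
    base = solve-∀
  evʳ-∷ʳ (b ∷ p) a x = begin
    b * x ^ length (p ++ [ a ]) + evʳ (p ++ [ a ]) x ≡⟨ cong₂ (λ k t → b * x ^ k + t) (trans (length-++ p) (ℕ.+-comm _ 1)) (evʳ-∷ʳ p a x) ⟩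
    b * x ^ suc (length p) + (a + x * evʳ p x)       ≡⟨ regroup a b x (evʳ p x) (x ^ length p) ⟩
    a + x * (b * x ^ length p + evʳ p x)             ∎
    where
    regroup : ∀ a b x s t → b * (x * t) + (a + x * s) ≡ a + x * (b * t + s)
    regroup = solve-∀

  evʳ-reverse : ∀ p x → evʳ (reverse p) x ≡ ev p x
  evʳ-reverse []      x = refl
  evʳ-reverse (a ∷ p) x = begin
    evʳ (reverse (a ∷ p)) x      ≡⟨ cong (λ q → evʳ q x) (unfold-reverse a p) ⟩
    evʳ (reverse p ++ [ a ]) x   ≡⟨ evʳ-∷ʳ (reverse p) a x ⟩
    a + x * evʳ (reverse p) x    ≡⟨ cong (λ t → a + x * t) (evʳ-reverse p x) ⟩
    a + x * ev p x               ∎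

  ev-reverse : ∀ p x → ev (reverse p) x ≡ evʳ p x
  ev-reverse p x = trans (sym (evʳ-reverse (reverse p) x)) (cong (λ q → evʳ q x) (reverse-involutive p))

  ev-replicate-0 : ∀ m x → ev (replicate m 0ℤ) x ≡ 0ℤ
  ev-replicate-0 zero    x = refl
  ev-replicate-0 (suc m) x = trans (+-identityˡ _) (trans (cong (x *_) (ev-replicate-0 m x)) (*-zeroʳ x))

  -- The constant terms agree because their difference is divisible by every large x.
  ev-injective : ∀ N p q → length p ≡ length q →
    (∀ x → N ℕ.< x → ev p (+ x) ≡ ev q (+ x)) → p ≡ q
  ev-injective N []      []      _   _  = refl
  ev-injective N (a ∷ p) (b ∷ q) len eq = cong₂ _∷_ a≡b (ev-injective N p q (ℕ.suc-injective len) tails)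
    where
    -- Exceeds the threshold `N` and also |a - b|, whose only multiple of `y` in reach is 0.
    y = suc (N ℕ.+ ∣ a - b ∣)

    shift : ∀ a b x s t → a + x * s ≡ b + x * t → a - b ≡ (t - s) * x
    shift a b x s t h = begin
      a - b                   ≡⟨ regroup a b x s ⟩
      a + x * s - b - x * s   ≡⟨ cong (λ u → u - b - x * s) h ⟩
      b + x * t - b - x * s   ≡⟨ regroup′ b x s t ⟩
      (t - s) * x             ∎
      where
      regroup : ∀ a b x s → a - b ≡ a + x * s - b - x * s
      regroup = solve-∀
      regroup′ : ∀ b x s t → b + x * t - b - x * s ≡ (t - s) * x
      regroup′ = solve-∀

    small-multiple : ∀ d → suc (N ℕ.+ d) ℕ.∣ d → d ≡ 0
    small-multiple zero    _ = refl
    small-multiple (suc d) h with () ← ℕ.<⇒≱ (ℕ.s≤s (ℕ.m≤n+m (suc d) N)) (ℕ.∣⇒≤ h)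

    a≡b : a ≡ b
    a≡b = i-j≡0⇒i≡j a b (∣i∣≡0⇒i≡0 (small-multiple _ (∣⇒∣ᵤ (divides {+ y} (ev q (+ y) - ev p (+ y))
      (shift a b (+ y) (ev p (+ y)) (ev q (+ y)) (eq y (ℕ.s≤s (ℕ.m≤m+n N _))))))))

    tails : ∀ x → N ℕ.< x → ev p (+ x) ≡ ev q (+ x)
    tails (suc x) N<x = *-cancelˡ-≡ (+ suc x) _ _ (+-cancelˡ a _ _ (trans (eq (suc x) N<x) (cong (_+ _) (sym a≡b))))

  -- Monic polynomials and exact division

  ^-split : ∀ x {m n} → m ℕ.≤ n → x ^ m * x ^ (n ℕ.∸ m) ≡ x ^ n
  ^-split x {m} {n} m≤n = trans (sym (^-distribˡ-+-* x m _)) (cong (x ^_) (ℕ.m+[n∸m]≡n m≤n))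

  pos-^ : ∀ m n → + (m ℕ.^ n) ≡ (+ m) ^ n
  pos-^ m zero    = refl
  pos-^ m (suc n) = trans (pos-* m (m ℕ.^ n)) (cong (+ m *_) (pos-^ m n))

  -- Splitting off the last entry rules out trailing zeros, so that the length of the list
  -- determines the degree exactly.
  Monic : ℕ → Poly → Set
  Monic d p = ∃ λ q → length q ≡ d × p ≡ q ++ [ 1ℤ ]

  length-monic : ∀ {d p} → Monic d p → length p ≡ suc d
  length-monic (q , refl , refl) = trans (length-++ q) (ℕ.+-comm _ 1)

  +P-identityʳ : ∀ p → p +P [] ≡ p
  +P-identityʳ []      = refl
  +P-identityʳ (a ∷ p) = refl

  +P-monic : ∀ u {d p} → length u ℕ.≤ d → Monic d p → Monic d (u +P p)
  +P-monic []      _          m = m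
  +P-monic (a ∷ u) (ℕ.s≤s le) (b ∷ q , refl , refl) =
    let (q′ , lq , eq) = +P-monic u le (q , refl , refl)
    in a + b ∷ q′ , cong suc lq , cong (_ ∷_) eq

  map-1* : ∀ p → map (1ℤ *_) p ≡ p
  map-1* []      = refl
  map-1* (a ∷ p) = cong₂ _∷_ (*-identityˡ a) (map-1* p)

  *P-monic : ∀ {d e p q} → Monic d p → Monic e q → Monic (d ℕ.+ e) (p *P q)
  *P-monic {e = e} {q = q} ([] , refl , refl) m@(r , refl , refl) =
    subst (Monic e) (trans (sym (unit r)) (cong (_+P [ 0ℤ ]) (sym (map-1* q)))) m
    where
    unit : ∀ r → (r ++ [ 1ℤ ]) +P [ 0ℤ ] ≡ r ++ [ 1ℤ ]
    unit []      = refl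
    unit (a ∷ r) = cong₂ _∷_ (+-identityʳ a) (+P-identityʳ _)
  *P-monic {e = e} {q = q} (a ∷ s , refl , refl) m with *P-monic (s , refl , refl) m
  ... | t , lt , eq = +P-monic (map (a *_) q)
    (subst (ℕ._≤ suc (length s ℕ.+ e)) (sym (trans (length-map (a *_) q) (length-monic m))) (ℕ.s≤s (ℕ.m≤n+m e _)))
    (0ℤ ∷ t , cong suc lt , cong (0ℤ ∷_) eq)

  evʳ-map-* : ∀ c p x → evʳ (map (c *_) p) x ≡ c * evʳ p x
  evʳ-map-* c []      x = sym (*-zeroʳ c)
  evʳ-map-* c (a ∷ p) x = begin
    c * a * x ^ length (map (c *_) p) + evʳ (map (c *_) p) x ≡⟨ cong₂ (λ k t → c * a * x ^ k + t) (length-map (c *_) p) (evʳ-map-* c p x) ⟩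
    c * a * x ^ length p + c * evʳ p x                       ≡⟨ regroup c a (x ^ length p) (evʳ p x) ⟩
    c * (a * x ^ length p + evʳ p x)                         ∎
    where
    regroup : ∀ c a s t → c * a * s + c * t ≡ c * (a * s + t)
    regroup = solve-∀

  length-subPref : ∀ p q → length q ℕ.≤ length p → length (subPref p q) ≡ length p
  length-subPref []      []      _          = refl
  length-subPref (a ∷ p) []      _          = refl
  length-subPref (a ∷ p) (b ∷ q) (ℕ.s≤s le) = cong suc (length-subPref p q le)

  -- `subPref` aligns leading coefficients, so `q` is in effect multiplied by the power of x that
  -- makes up the difference in length.
  evʳ-subPref : ∀ p q x → length q ℕ.≤ length p →
    evʳ p x ≡ evʳ (subPref p q) x + evʳ q x * x ^ (length p ℕ.∸ length q)
  evʳ-subPref []      []      x _ = refl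
  evʳ-subPref (a ∷ p) []      x _ = sym (+-identityʳ _)
  evʳ-subPref (a ∷ p) (b ∷ q) x (ℕ.s≤s le) = begin
    a * x ^ length p + evʳ p x
      ≡⟨ cong₂ (λ s t → a * s + t) (sym (^-split x le)) (evʳ-subPref p q x le) ⟩
    a * (x ^ length q * y) + (evʳ (subPref p q) x + evʳ q x * y)
      ≡⟨ regroup a b (x ^ length q) y (evʳ (subPref p q) x) (evʳ q x) ⟩
    (a - b) * (x ^ length q * y) + evʳ (subPref p q) x + (b * x ^ length q + evʳ q x) * y
      ≡⟨ cong (λ s → (a - b) * s + evʳ (subPref p q) x + (b * x ^ length q + evʳ q x) * y)
          (trans (^-split x le) (cong (x ^_) (sym (length-subPref p q le)))) ⟩
    (a - b) * x ^ length (subPref p q) + evʳ (subPref p q) x + (b * x ^ length q + evʳ q x) * y ∎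
    where
    y = x ^ (length p ℕ.∸ length q)
    regroup : ∀ a b s y t u → a * (s * y) + (t + u * y) ≡ (a - b) * (s * y) + t + (b * s + u) * y
    regroup = solve-∀

  divHF-step : ∀ f b B a as → length B ℕ.≤ length as →
    divHF (suc f) (b ∷ B) (a ∷ as) ≡ a ∷ divHF f (b ∷ B) (subPref as (map (a *_) B))
  divHF-step f b B a as le
    rewrite divHF-eq f b B a as with length (b ∷ B) ℕ.≤ᵇ suc (length as) | ℕ.≤⇒≤ᵇ (ℕ.s≤s le)
  ... | true | _ = refl

  divHF-stop : ∀ f b B a as → ¬ length B ℕ.≤ length as → divHF (suc f) (b ∷ B) (a ∷ as) ≡ []
  divHF-stop f b B a as nle
    rewrite divHF-eq f b B a as with length (b ∷ B) ℕ.≤ᵇ suc (length as) | ℕ.≤ᵇ⇒≤ (length (b ∷ B)) (suc (length as))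
  ... | false | _ = refl
  ... | true  | h = ⊥-elim (nle (ℕ.s≤s⁻¹ (h _)))

  length-subPref-map : ∀ p c q → length q ℕ.≤ length p → length (subPref p (map (c *_) q)) ≡ length p
  length-subPref-map p c q le = length-subPref p _ (subst (ℕ._≤ length p) (sym (length-map (c *_) q)) le)

  -- Each step shortens the dividend by exactly one entry and zeros are never trimmed. So fuel
  -- `length A` does not run out, and the length of the quotient depends on lengths alone.
  length-divHF : ∀ f b B A → length A ℕ.≤ f → length (divHF f (b ∷ B) A) ≡ length A ℕ.∸ length B
  length-divHF zero    b B []       _ = sym (ℕ.0∸n≡0 (length B))
  length-divHF (suc f) b B []       _ = sym (ℕ.0∸n≡0 (length B))
  length-divHF (suc f) b B (a ∷ as) (ℕ.s≤s le) with length B ℕ.≤? length as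
  ... | no nle = trans (cong length (divHF-stop f b B a as nle)) (sym (ℕ.m≤n⇒m∸n≡0 (ℕ.≰⇒> nle)))
  ... | yes B≤as = begin
    length (divHF (suc f) (b ∷ B) (a ∷ as)) ≡⟨ cong length (divHF-step f b B a as B≤as) ⟩
    suc (length (divHF f (b ∷ B) A′))       ≡⟨ cong suc (length-divHF f b B A′ (subst (ℕ._≤ f) (sym lA′) le)) ⟩
    suc (length A′ ℕ.∸ length B)            ≡⟨ cong (λ l → suc (l ℕ.∸ length B)) lA′ ⟩
    suc (length as ℕ.∸ length B)            ≡⟨ ℕ.+-∸-assoc 1 B≤as ⟨
    suc (length as) ℕ.∸ length B            ∎
    where
    A′  = subPref as (map (a *_) B)
    lA′ = length-subPref-map as a B B≤as

  -- The algorithm returns only the quotient; the remainder is the dividend at which the recursion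
  -- stops. As `B` omits the leading 1, the length bound says that its degree is below that of the
  -- divisor.
  divHF-remainder : ∀ f B A → length A ℕ.≤ f → ∃ λ R → length R ℕ.≤ length B ×
    (∀ x → evʳ A x ≡ evʳ (divHF f (1ℤ ∷ B) A) x * evʳ (1ℤ ∷ B) x + evʳ R x)
  divHF-remainder zero    B []       _ = [] , ℕ.z≤n , λ x → refl
  divHF-remainder (suc f) B []       _ = [] , ℕ.z≤n , λ x → refl
  divHF-remainder (suc f) B (a ∷ as) (ℕ.s≤s le) with length B ℕ.≤? length as
  ... | no nle rewrite divHF-stop f 1ℤ B a as nle = a ∷ as , ℕ.≰⇒> nle , λ x → sym (+-identityˡ _)
  ... | yes B≤as rewrite divHF-step f 1ℤ B a as B≤as = R , lR , λ x → begin
      a * x ^ length as + evʳ as x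
        ≡⟨ cong₂ (λ s t → a * s + t) (sym (^-split x B≤as)) (trans (evʳ-subPref as (map (a *_) B) x aB≤as)
             (cong₂ _+_ (spec x) (cong₂ (λ t l → t * x ^ (length as ℕ.∸ l)) (evʳ-map-* a B x) (length-map (a *_) B)))) ⟩
      a * (x ^ length B * x ^ k)
        + (evʳ Q x * evʳ (1ℤ ∷ B) x + evʳ R x + a * evʳ B x * x ^ k)
        ≡⟨ regroup a (x ^ length B) (x ^ k) (evʳ Q x) (evʳ B x) (evʳ R x) ⟩
      (a * x ^ k + evʳ Q x) * evʳ (1ℤ ∷ B) x + evʳ R x
        ≡⟨ cong (λ l → (a * x ^ l + evʳ Q x) * evʳ (1ℤ ∷ B) x + evʳ R x)
             (trans (cong (ℕ._∸ length B) (sym lA′)) (sym (length-divHF f 1ℤ B A′ A′≤f))) ⟩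
      (a * x ^ length Q + evʳ Q x) * evʳ (1ℤ ∷ B) x + evʳ R x ∎
    where
    k     = length as ℕ.∸ length B
    A′    = subPref as (map (a *_) B)
    Q     = divHF f (1ℤ ∷ B) A′
    aB≤as = subst (ℕ._≤ length as) (sym (length-map (a *_) B)) B≤as
    lA′   = length-subPref as _ aB≤as
    A′≤f  = subst (ℕ._≤ f) (sym lA′) le
    IH    = divHF-remainder f B A′ A′≤f
    R     = proj₁ IH
    lR    = proj₁ (proj₂ IH)
    spec  = proj₂ (proj₂ IH)
    regroup : ∀ a s y q t r →
      a * (s * y) + (q * (1ℤ * s + t) + r + a * t * y) ≡ (a * y + q) * (1ℤ * s + t) + r
    regroup = solve-∀

  divMonic-monic : ∀ {n m A B} → Monic n A → Monic m B → m ℕ.≤ n → Monic (n ℕ.∸ m) (divMonic A B)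
  divMonic-monic {A = A} {B} (a , refl , refl) (b , refl , refl) m≤n =
    reverse Q , trans (length-reverse Q) lQ , (begin
      divMonic A B
        ≡⟨ divMonic-eq A B ⟩
      reverse (divHF (length A) (reverse B) (reverse A))
        ≡⟨ cong reverse (cong₂ (λ l → divHF l (reverse B)) (trans (length-++ a) (ℕ.+-comm _ 1)) (reverse-++ a [ 1ℤ ])) ⟩
      reverse (divHF (suc (length a)) (reverse B) (1ℤ ∷ reverse a))
        ≡⟨ cong (λ t → reverse (divHF (suc (length a)) t (1ℤ ∷ reverse a))) (reverse-++ b [ 1ℤ ]) ⟩
      reverse (divHF (suc (length a)) (1ℤ ∷ reverse b) (1ℤ ∷ reverse a))
        ≡⟨ cong reverse (divHF-step (length a) 1ℤ (reverse b) 1ℤ (reverse a) b≤a) ⟩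
      reverse (1ℤ ∷ Q)
        ≡⟨ unfold-reverse 1ℤ Q ⟩
      reverse Q ++ [ 1ℤ ] ∎)
    where
    A′  = subPref (reverse a) (map (1ℤ *_) (reverse b))
    Q   = divHF (length a) (1ℤ ∷ reverse b) A′
    b≤a = subst₂ ℕ._≤_ (sym (length-reverse b)) (sym (length-reverse a)) m≤n
    lA′ : length A′ ≡ length a
    lA′ = trans (length-subPref-map (reverse a) 1ℤ (reverse b) b≤a) (length-reverse a)
    lQ : length Q ≡ length a ℕ.∸ length b
    lQ = trans (length-divHF (length a) 1ℤ (reverse b) A′ (ℕ.≤-reflexive lA′)) (cong₂ ℕ._∸_ lA′ (length-reverse b))

  divMonic-remainder : ∀ {m} A B → Monic m B → ∃ λ R → length R ℕ.≤ m ×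
    (∀ x → ev A x ≡ ev (divMonic A B) x * ev B x + ev R x)
  divMonic-remainder A B (b , refl , refl) =
    let (R , lR , spec) = divHF-remainder (length A) (reverse b) (reverse A) (ℕ.≤-reflexive (length-reverse A))
        hf              = reverse-++ b [ 1ℤ ]
        Q               = divHF (length A) (1ℤ ∷ reverse b) (reverse A)
        q               = trans (divMonic-eq A B) (cong (λ t → reverse (divHF (length A) t (reverse A))) hf)
    in reverse R , subst₂ ℕ._≤_ (sym (length-reverse R)) (length-reverse b) lR , λ x → begin
      ev A x                                                 ≡⟨ evʳ-reverse A x ⟨
      evʳ (reverse A) x                                      ≡⟨ spec x ⟩
      evʳ Q x * evʳ (1ℤ ∷ reverse b) x + evʳ R x             ≡⟨ cong₂ _+_ (cong₂ _*_ (trans (sym (ev-reverse Q x)) (cong (λ t → ev t x) (sym q)))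
                                                                                     (trans (cong (λ t → evʳ t x) (sym hf)) (evʳ-reverse B x)))
                                                                          (sym (ev-reverse R x)) ⟩
      ev (divMonic A B) x * ev B x + ev (reverse R) x        ∎

  norm : Poly → ℕ
  norm []      = 0
  norm (a ∷ p) = ∣ a ∣ ℕ.+ norm p

  ∣ev∣≤norm : ∀ p d x .{{_ : ℕ.NonZero x}} → length p ℕ.≤ suc d → ∣ ev p (+ x) ∣ ℕ.≤ norm p ℕ.* x ℕ.^ d
  ∣ev∣≤norm []          d       x le = ℕ.z≤n
  ∣ev∣≤norm (a ∷ p)     d       x (ℕ.s≤s le) = ℕ.≤-trans (∣i+j∣≤∣i∣+∣j∣ a _)
    (ℕ.≤-trans (ℕ.+-mono-≤ (ℕ.m≤m*n ∣ a ∣ (x ℕ.^ d) {{ℕ.m^n≢0 x d}}) (tail-bound p d le))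
               (ℕ.≤-reflexive (sym (ℕ.*-distribʳ-+ (x ℕ.^ d) ∣ a ∣ (norm p)))))
    where
    tail-bound : ∀ p d → length p ℕ.≤ d → ∣ + x * ev p (+ x) ∣ ℕ.≤ norm p ℕ.* x ℕ.^ d
    tail-bound []      d       _  = ℕ.≤-reflexive (cong ∣_∣ (*-zeroʳ (+ x)))
    tail-bound (b ∷ p) (suc d) le = ℕ.≤-trans (ℕ.≤-reflexive (abs-* (+ x) (ev (b ∷ p) (+ x))))
      (ℕ.≤-trans (ℕ.*-monoʳ-≤ x (∣ev∣≤norm (b ∷ p) d x le)) (ℕ.≤-reflexive (x∙yz≈y∙xz x (norm (b ∷ p)) (x ℕ.^ d))))
      where open import Algebra.Properties.CommutativeSemigroup ℕ.*-commutativeSemigroup using (x∙yz≈y∙xz)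

  -- For large x the remainder is smaller than the divisor, so divisibility of its
  -- values forces it to vanish.
  small-remainder-vanishes : ∀ {m B} R k N .{{_ : ℕ.NonZero k}} → Monic m B → length R ℕ.≤ m →
    (∀ x → N ℕ.< x → ev B (+ x) ∣ + k * ev R (+ x)) → ∀ x → ev R x ≡ 0ℤ
  small-remainder-vanishes {zero}          []      k N _ _ _ x = refl
  small-remainder-vanishes {suc d} {B = B} R k N {{k≢0}} (L , lL , refl) lR div x =
    trans (cong (λ p → ev p x) R≡0) (ev-replicate-0 (length R) x)
    where
    -- If R(y) ≠ 0 for some y > N, divisibility gives |B(y)| ≤ k‖R‖yᵈ. Since B(y) - L(y) is y to the
    -- power d + 1 and |L(y)| ≤ ‖L‖yᵈ, it follows that y ≤ k‖R‖ + ‖L‖.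
    N′ = N ℕ.+ (k ℕ.* norm R ℕ.+ norm L)

    vanish : ∀ y → N′ ℕ.< y → ev R (+ y) ≡ 0ℤ
    vanish y@(suc _) N′<y with ev R (+ y) ≟ 0ℤ
    ... | yes p = p
    ... | no ne = ⊥-elim (ℕ.<⇒≱ N′<y (ℕ.≤-trans y≤ (ℕ.m≤n+m _ N)))
      where
      kR≢0 : ℕ.NonZero ∣ + k * ev R (+ y) ∣
      kR≢0 = i*j≢0 (+ k) (ev R (+ y)) {{k≢0}} {{≢-nonZero ne}}

      B≤ : ∣ ev B (+ y) ∣ ℕ.≤ k ℕ.* (norm R ℕ.* y ℕ.^ d)
      B≤ = ℕ.≤-trans (ℕ.∣⇒≤ {{kR≢0}} (∣⇒∣ᵤ (div y (ℕ.≤-<-trans (ℕ.m≤m+n N _) N′<y))))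
             (ℕ.≤-trans (ℕ.≤-reflexive (abs-* (+ k) (ev R (+ y)))) (ℕ.*-monoʳ-≤ k (∣ev∣≤norm R d y lR)))

      power : + (y ℕ.^ suc d) ≡ ev B (+ y) - ev L (+ y)
      power = begin
        + (y ℕ.^ suc d)                              ≡⟨ pos-^ y (suc d) ⟩
        (+ y) ^ suc d                                ≡⟨ regroup (ev L (+ y)) _ ⟩
        ev L (+ y) + 1ℤ * (+ y) ^ suc d - ev L (+ y) ≡⟨ cong (λ l → ev L (+ y) + 1ℤ * (+ y) ^ l - ev L (+ y)) lL ⟨
        ev L (+ y) + 1ℤ * (+ y) ^ length L - ev L (+ y) ≡⟨ cong (_- ev L (+ y)) (ev-∷ʳ L 1ℤ (+ y)) ⟨
        ev B (+ y) - ev L (+ y)                      ∎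
        where
        regroup : ∀ l p → p ≡ l + 1ℤ * p - l
        regroup = solve-∀

      y≤ : y ℕ.≤ k ℕ.* norm R ℕ.+ norm L
      y≤ = ℕ.*-cancelʳ-≤ y _ (y ℕ.^ d) {{ℕ.m^n≢0 y d}} (ℕ.≤-trans (ℕ.≤-reflexive (cong ∣_∣ power))
        (ℕ.≤-trans (∣i-j∣≤∣i∣+∣j∣ (ev B (+ y)) (ev L (+ y)))
        (ℕ.≤-trans (ℕ.+-mono-≤ B≤ (∣ev∣≤norm L d y (ℕ.≤-reflexive lL)))
        (ℕ.≤-reflexive (trans (cong (ℕ._+ norm L ℕ.* y ℕ.^ d) (sym (ℕ.*-assoc k (norm R) _)))
                              (sym (ℕ.*-distribʳ-+ (y ℕ.^ d) (k ℕ.* norm R) (norm L))))))))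

    R≡0 : R ≡ replicate (length R) 0ℤ
    R≡0 = ev-injective N′ R _ (sym (length-replicate (length R)))
            (λ y N′<y → trans (vanish y N′<y) (sym (ev-replicate-0 (length R) (+ y))))

  -- From kA = kQB + kR the remainder inherits the divisibility. Large positive arguments are enough
  -- to make it zero, and the resulting identity then holds at every integer.
  divMonic-exact : ∀ {m} A B k N .{{_ : ℕ.NonZero k}} → Monic m B →
    (∀ x → N ℕ.< x → ev B (+ x) ∣ + k * ev A (+ x)) →
    ∀ x → ev A x ≡ ev (divMonic A B) x * ev B x
  divMonic-exact A B k N mB div x with divMonic-remainder A B mB
  ... | R , lR , spec = trans (spec x) (trans (cong (λ r → ev (divMonic A B) x * ev B x + r) (small-remainder-vanishes R k N mB lR div′ x)) (+-identityʳ _))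
    where
    Q = divMonic A B
    div′ : ∀ y → N ℕ.< y → ev B (+ y) ∣ + k * ev R (+ y)
    div′ y N<y = ∣m+n∣m⇒∣n (subst (ev B (+ y) ∣_) (begin
        + k * ev A (+ y)                              ≡⟨ cong (+ k *_) (spec (+ y)) ⟩
        + k * (ev Q (+ y) * ev B (+ y) + ev R (+ y))  ≡⟨ regroup (+ k) (ev Q (+ y)) (ev B (+ y)) (ev R (+ y)) ⟩
        + k * ev Q (+ y) * ev B (+ y) + + k * ev R (+ y) ∎) (div y N<y))
      (∣n⇒∣m*n (+ k * ev Q (+ y)) ∣-refl)
      where
      regroup : ∀ k q b r → k * (q * b + r) ≡ k * q * b + k * r
      regroup = solve-∀

  -- Integer values of cyclotomic polynomials

  -- The product index runs from 1 to n.
  ∏ : ℕ → (ℕ → ℤ) → ℤ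
  ∏ zero    f = 1ℤ
  ∏ (suc n) f = ∏ n f * f (suc n)

  -- Non-divisors contribute 1, so products over the divisors of different numbers share an index
  -- range and can be compared factor by factor.
  divisorFactor : (ℕ → ℤ) → ℕ → ℕ → ℤ
  divisorFactor F n d = if does (d ℕ.∣? n) then F d else 1ℤ

  ∏∣ : (ℕ → ℤ) → ℕ → ℕ → ℤ
  ∏∣ F n m = ∏ m (divisorFactor F n)

  divisorFactor-yes : ∀ F {n d} → d ℕ.∣ n → divisorFactor F n d ≡ F d
  divisorFactor-yes F {n} {d} d∣n with d ℕ.∣? n
  ... | yes _  = refl
  ... | no d∤n = ⊥-elim (d∤n d∣n)

  divisorFactor-no : ∀ F {n d} → ¬ d ℕ.∣ n → divisorFactor F n d ≡ 1ℤ
  divisorFactor-no F {n} {d} d∤n with d ℕ.∣? n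
  ... | yes d∣n = ⊥-elim (d∤n d∣n)
  ... | no _    = refl

  ∏∣-yes : ∀ F n m → suc m ℕ.∣ n → ∏∣ F n (suc m) ≡ ∏∣ F n m * F (suc m)
  ∏∣-yes F n m d∣n = cong (∏∣ F n m *_) (divisorFactor-yes F d∣n)

  ∏∣-no : ∀ F n m → ¬ suc m ℕ.∣ n → ∏∣ F n (suc m) ≡ ∏∣ F n m
  ∏∣-no F n m d∤n = trans (cong (∏∣ F n m *_) (divisorFactor-no F d∤n)) (*-identityʳ _)

  *-mono-∣ : ∀ {a b c d} → a ∣ b → c ∣ d → a * c ∣ b * d
  *-mono-∣ {a} {b} {c} {d} a∣b c∣d = ∣-trans (*-monoˡ-∣ c {a} {b} a∣b) (*-monoʳ-∣ b {c} {d} c∣d)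

  ∏-mono-∣ : ∀ n {f g} → (∀ i → f i ∣ g i) → ∏ n f ∣ ∏ n g
  ∏-mono-∣ zero    h = ∣-refl
  ∏-mono-∣ (suc n) h = *-mono-∣ (∏-mono-∣ n h) (h (suc n))

  ∏-≤-∣ : ∀ {m n} f → m ℕ.≤ n → ∏ m f ∣ ∏ n f
  ∏-≤-∣ {m} {n} f m≤n = subst (λ k → ∏ m f ∣ ∏ k f) (ℕ.m∸n+n≡m m≤n) (go (n ℕ.∸ m))
    where
    go : ∀ k → ∏ m f ∣ ∏ (k ℕ.+ m) f
    go zero    = ∣-refl
    go (suc k) = ∣m⇒∣m*n (f (suc (k ℕ.+ m))) (go k)

  divisorFactor-mono : ∀ F {g b} → g ℕ.∣ b → ∀ e → divisorFactor F g e ∣ divisorFactor F b e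
  divisorFactor-mono F {g} {b} g∣b e with e ℕ.∣? g
  ... | yes e∣g = ∣-reflexive (sym (divisorFactor-yes F (ℕ.∣-trans e∣g g∣b)))
  ... | no  _   = divides (divisorFactor F b e) (sym (*-identityʳ _))

  _∈⟨_,_⟩ : ℤ → ℤ → ℤ → Set
  c ∈⟨ a , b ⟩ = ∃₂ λ u v → c ≡ u * a + v * b

  ∈-*ˡ : ∀ k {c a b} → c ∈⟨ a , b ⟩ → (k * c) ∈⟨ a , b ⟩
  ∈-*ˡ k {a = a} {b} (u , v , e) = k * u , k * v , trans (cong (k *_) e) (regroup k u v a b)
    where
    regroup : ∀ k u v a b → k * (u * a + v * b) ≡ k * u * a + k * v * b
    regroup = solve-∀

  -- Both ideals contain `b`, so in the product of the two combinations every term is a multiple of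
  -- `b` except the one in `p * a`.
  ∈-product : ∀ {c d a p b} → c ∈⟨ a , b ⟩ → d ∈⟨ p , b ⟩ → (c * d) ∈⟨ p * a , b ⟩
  ∈-product {a = a} {p} {b} (s , t , e) (u , v , e′) =
    s * u , t * (u * p + v * b) + s * a * v , trans (cong₂ _*_ e e′) (regroup s t u v a b p)
    where
    regroup : ∀ s t u v a b p → (s * a + t * b) * (u * p + v * b) ≡
      s * u * (p * a) + (t * (u * p + v * b) + s * a * v) * b
    regroup = solve-∀

  -- A quantitative form of the rule that coprime divisors may be multiplied: c z = u a z + v b z,
  -- and each summand contains both `a` and `b`.
  ∈-divides : ∀ {c a b z} → c ∈⟨ a , b ⟩ → a ∣ z → b ∣ z → a * b ∣ c * z
  ∈-divides {c} {a} {b} {z} (u , v , e) (divides q eq) (divides r er) = divides (u * r + v * q) (begin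
    c * z                              ≡⟨ cong (_* z) e ⟩
    (u * a + v * b) * z                ≡⟨ *-distribʳ-+ z (u * a) (v * b) ⟩
    u * a * z + v * b * z              ≡⟨ cong₂ (λ y y′ → u * a * y + v * b * y′) er eq ⟩
    u * a * (r * b) + v * b * (q * a)  ≡⟨ regroup u v a b q r ⟩
    (u * r + v * q) * (a * b)          ∎)
    where
    regroup : ∀ u v a b q r → u * a * (r * b) + v * b * (q * a) ≡ (u * r + v * q) * (a * b)
    regroup = solve-∀

  -- The cofactor is 1 + y + ... + yᵏ⁻¹, written so as to exhibit its residue k modulo y - 1.
  geometric : ∀ y k → ∃ λ h → y ^ k - 1ℤ ≡ (+ k + h * (y - 1ℤ)) * (y - 1ℤ)
  geometric y zero    = 0ℤ , refl
  geometric y (suc k) = let (h , eq) = geometric y k in h + (+ k + h * (y - 1ℤ)) , (begin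
    y * y ^ k - 1ℤ                                           ≡⟨ expand y (y ^ k) ⟩
    y * (y ^ k - 1ℤ) + (y - 1ℤ)                              ≡⟨ cong (λ t → y * t + (y - 1ℤ)) eq ⟩
    y * ((+ k + h * (y - 1ℤ)) * (y - 1ℤ)) + (y - 1ℤ)         ≡⟨ collect y (+ k) h ⟩
    (1ℤ + + k + (h + (+ k + h * (y - 1ℤ))) * (y - 1ℤ)) * (y - 1ℤ) ∎)
    where
    expand : ∀ y z → y * z - 1ℤ ≡ y * (z - 1ℤ) + (y - 1ℤ)
    expand = solve-∀
    collect : ∀ y k h → y * ((k + h * (y - 1ℤ)) * (y - 1ℤ)) + (y - 1ℤ) ≡
      (1ℤ + k + (h + (k + h * (y - 1ℤ))) * (y - 1ℤ)) * (y - 1ℤ)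
    collect = solve-∀

  x^m-1∣x^km-1 : ∀ x m k → x ^ m - 1ℤ ∣ x ^ (k ℕ.* m) - 1ℤ
  x^m-1∣x^km-1 x m k = let (h , eq) = geometric (x ^ m) k in
    divides (+ k + h * (x ^ m - 1ℤ)) (trans (cong (_- 1ℤ) (trans (cong (x ^_) (ℕ.*-comm k m)) (sym (^-*-assoc x m k)))) eq)

  x^d-1∣x^n-1 : ∀ x {d n} → d ℕ.∣ n → x ^ d - 1ℤ ∣ x ^ n - 1ℤ
  x^d-1∣x^n-1 x {d} (ℕ.divides k refl) = x^m-1∣x^km-1 x d k

  -- With Bézout over ℕ no negative exponent occurs: if g + j b = i a, then xᵍ - 1 is the difference
  -- of x^(i a) - 1 and xᵍ (x^(j b) - 1).
  x^gcd-1∈ : ∀ x a b → (x ^ gcd a b - 1ℤ) ∈⟨ x ^ a - 1ℤ , x ^ b - 1ℤ ⟩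
  x^gcd-1∈ x a b with Bézout.identity (gcd-GCD a b)
  ... | Bézout.+- i j eq with x^m-1∣x^km-1 x a i | x^m-1∣x^km-1 x b j
  ...   | divides p ep | divides q eq′ = p , - (x ^ gcd a b * q) , (begin
    x ^ gcd a b - 1ℤ                                              ≡⟨ difference (x ^ gcd a b) (x ^ (j ℕ.* b)) ⟩
    (x ^ gcd a b * x ^ (j ℕ.* b) - 1ℤ) - x ^ gcd a b * (x ^ (j ℕ.* b) - 1ℤ)
      ≡⟨ cong₂ (λ s t → s - x ^ gcd a b * t) (trans (cong (_- 1ℤ) (trans (sym (^-distribˡ-+-* x (gcd a b) _)) (cong (x ^_) eq))) ep) eq′ ⟩
    p * (x ^ a - 1ℤ) - x ^ gcd a b * (q * (x ^ b - 1ℤ))           ≡⟨ regroup (x ^ gcd a b) p q (x ^ a) (x ^ b) ⟩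
    p * (x ^ a - 1ℤ) + - (x ^ gcd a b * q) * (x ^ b - 1ℤ)         ∎)
    where
    difference : ∀ y z → y - 1ℤ ≡ (y * z - 1ℤ) - y * (z - 1ℤ)
    difference = solve-∀
    regroup : ∀ y p q s t → p * (s - 1ℤ) - y * (q * (t - 1ℤ)) ≡ p * (s - 1ℤ) + - (y * q) * (t - 1ℤ)
    regroup = solve-∀
  x^gcd-1∈ x a b | Bézout.-+ i j eq with x^m-1∣x^km-1 x a i | x^m-1∣x^km-1 x b j
  ...   | divides p ep | divides q eq′ = - (x ^ gcd a b * p) , q , (begin
    x ^ gcd a b - 1ℤ                                              ≡⟨ difference (x ^ gcd a b) (x ^ (i ℕ.* a)) ⟩
    (x ^ gcd a b * x ^ (i ℕ.* a) - 1ℤ) - x ^ gcd a b * (x ^ (i ℕ.* a) - 1ℤ)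
      ≡⟨ cong₂ (λ s t → s - x ^ gcd a b * t) (trans (cong (_- 1ℤ) (trans (sym (^-distribˡ-+-* x (gcd a b) _)) (cong (x ^_) eq))) eq′) ep ⟩
    q * (x ^ b - 1ℤ) - x ^ gcd a b * (p * (x ^ a - 1ℤ))           ≡⟨ regroup (x ^ gcd a b) p q (x ^ a) (x ^ b) ⟩
    - (x ^ gcd a b * p) * (x ^ a - 1ℤ) + q * (x ^ b - 1ℤ)         ∎)
    where
    difference : ∀ y z → y - 1ℤ ≡ (y * z - 1ℤ) - y * (z - 1ℤ)
    difference = solve-∀
    regroup : ∀ y p q s t → q * (t - 1ℤ) - y * (p * (s - 1ℤ)) ≡ - (y * p) * (s - 1ℤ) + q * (t - 1ℤ)
    regroup = solve-∀

  -- The exponent t of the overview: adjoining the factor of index m + 1 costs one factor n for each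
  -- of the m smaller indices.
  triangle : ℕ → ℕ
  triangle zero    = 0
  triangle (suc m) = m ℕ.+ triangle m

  -- Near-coprimality of cyclotomic values at a fixed integer

  module CyclotomicValues (x : ℤ) (x^≢1 : ∀ g → 1 ℕ.≤ g → x ^ g - 1ℤ ≢ 0ℤ) (F : ℕ → ℤ) (n : ℕ)
      (factorised : ∀ d → 1 ℕ.≤ d → d ℕ.< n → ∏∣ F d d ≡ x ^ d - 1ℤ) where

    F∣x^d-1 : ∀ d → 1 ℕ.≤ d → d ℕ.< n → F d ∣ x ^ d - 1ℤ
    F∣x^d-1 (suc d) 1≤d d<n = divides (∏∣ F (suc d) d) (trans (sym (factorised (suc d) 1≤d d<n))
      (∏∣-yes F (suc d) d ℕ.∣-refl))

    -- F b divides (x^b − 1)/(x^g − 1), which is congruent to b/g modulo x^g − 1.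
    ratio : ∀ {g b} → 1 ℕ.≤ g → g ℕ.< b → b ℕ.< n → (g∣b : g ℕ.∣ b) →
      (+ ℕ.quotient g∣b) ∈⟨ x ^ g - 1ℤ , F b ⟩
    ratio {g} {suc b} 1≤g (ℕ.s≤s g≤b) b<n g∣b@(ℕ.divides q b≡qg)
      -- Every divisor of `g` is a divisor of `suc b` not exceeding `b`. Hence (xᵍ - 1) ·
      -- `F (suc b)` divides x^(b+1) - 1, with cofactor `w`.
      with ∣-trans (∏-mono-∣ g (divisorFactor-mono F g∣b)) (∏-≤-∣ (divisorFactor F (suc b)) g≤b) | geometric (x ^ g) q
    ... | divides w ew | h , eh = - h , w , (begin
      + q                                          ≡⟨ regroup (+ q) h y ⟩
      - h * y + (+ q + h * y)                      ≡⟨ cong (λ t → - h * y + t) cancelled ⟨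
      - h * y + w * F (suc b)                      ∎)
      where
      y = x ^ g - 1ℤ
      regroup : ∀ q h y → q ≡ - h * y + (q + h * y)
      regroup = solve-∀
      swap : ∀ w f y → w * f * y ≡ w * y * f
      swap = solve-∀
      cancelled : w * F (suc b) ≡ + q + h * y
      cancelled = *-cancelʳ-≡ _ _ y {{≢-nonZero (x^≢1 g 1≤g)}} (begin
        w * F (suc b) * y                   ≡⟨ swap w (F (suc b)) y ⟩
        w * y * F (suc b)                   ≡⟨ cong (λ t → w * t * F (suc b)) (factorised g 1≤g (ℕ.≤-<-trans g≤b (ℕ.<-trans (ℕ.n<1+n b) b<n))) ⟨
        w * ∏∣ F g g * F (suc b)            ≡⟨ cong₂ _*_ ew (divisorFactor-yes F ℕ.∣-refl) ⟨
        ∏∣ F (suc b) (suc b)                ≡⟨ factorised (suc b) (ℕ.s≤s ℕ.z≤n) b<n ⟩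
        x ^ suc b - 1ℤ                      ≡⟨ cong (_- 1ℤ) (trans (cong (x ^_) (trans b≡qg (ℕ.*-comm q g))) (sym (^-*-assoc x g q))) ⟩
        (x ^ g) ^ q - 1ℤ                    ≡⟨ eh ⟩
        (+ q + h * y) * y                   ∎)

    -- With g = gcd(a, b), the ideal of the two values contains xᵃ - 1 and xᵇ - 1, hence xᵍ - 1, and
    -- then b/g by `ratio`. Multiplying by r g, where n = r b, gives n.
    coprime-values : ∀ {a b} → 1 ℕ.≤ a → a ℕ.< b → b ℕ.< n → b ℕ.∣ n → (+ n) ∈⟨ F a , F b ⟩
    coprime-values {a} {b} 1≤a a<b b<n (ℕ.divides r n≡rb)
      with F∣x^d-1 a 1≤a (ℕ.<-trans a<b b<n) | F∣x^d-1 b (ℕ.≤-trans 1≤a (ℕ.<⇒≤ a<b)) b<n | x^gcd-1∈ x a b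
         | ratio {gcd a b} {b} (ℕ.n≢0⇒n>0 λ g≡0 → ℕ.<⇒≢ 1≤a (sym (ℕ.0∣⇒≡0 (subst (ℕ._∣ a) g≡0 (gcd[m,n]∣m a b)))))
             (ℕ.≤-<-trans (ℕ.∣⇒≤ {{ℕ.>-nonZero 1≤a}} (gcd[m,n]∣m a b)) a<b) b<n (gcd[m,n]∣n a b)
    ... | divides α eα | divides β eβ | u , v , eg | s , t , eq =
      + (r ℕ.* gcd a b) * (s * (u * α)) , + (r ℕ.* gcd a b) * (s * (v * β) + t) , (begin
        + n                                                 ≡⟨ cong +_ n≡rgq ⟩
        + (r ℕ.* gcd a b ℕ.* q)                             ≡⟨ pos-* (r ℕ.* gcd a b) q ⟩
        R * + q                                             ≡⟨ cong (R *_) eq ⟩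
        R * (s * (x ^ gcd a b - 1ℤ) + t * F b)              ≡⟨ cong (λ z → R * (s * z + t * F b)) (trans eg (cong₂ (λ A B → u * A + v * B) eα eβ)) ⟩
        R * (s * (u * (α * F a) + v * (β * F b)) + t * F b) ≡⟨ regroup R s t u v α β (F a) (F b) ⟩
        R * (s * (u * α)) * F a + R * (s * (v * β) + t) * F b ∎)
      where
      q = ℕ.quotient (gcd[m,n]∣n a b)
      R = + (r ℕ.* gcd a b)
      n≡rgq : n ≡ r ℕ.* gcd a b ℕ.* q
      n≡rgq = trans n≡rb (trans (cong (r ℕ.*_) (trans (ℕ._∣_.equality (gcd[m,n]∣n a b)) (ℕ.*-comm q (gcd a b)))) (sym (ℕ.*-assoc r (gcd a b) q)))
      regroup : ∀ R s t u v α β f g → R * (s * (u * (α * f) + v * (β * g)) + t * g) ≡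
        R * (s * (u * α)) * f + R * (s * (v * β) + t) * g
      regroup = solve-∀

    coprime-product : ∀ m {b} → m ℕ.< b → b ℕ.< n → b ℕ.∣ n → ((+ n) ^ m) ∈⟨ ∏∣ F n m , F b ⟩
    coprime-product zero    m<b b<n b∣n = 1ℤ , 0ℤ , refl
    coprime-product (suc m) {b} m<b b<n b∣n = extend (suc m ℕ.∣? n)
      where
      IH = coprime-product m (ℕ.<-trans (ℕ.n<1+n m) m<b) b<n b∣n
      extend : Dec (suc m ℕ.∣ n) → ((+ n) ^ suc m) ∈⟨ ∏∣ F n (suc m) , F b ⟩
      extend (yes m∣n) = subst (λ P → ((+ n) ^ suc m) ∈⟨ P , F b ⟩) (sym (∏∣-yes F n m m∣n))
        (∈-product (coprime-values (ℕ.s≤s ℕ.z≤n) m<b b<n b∣n) IH)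
      -- An index that does not divide n is charged a factor n as well, so that the exponent depends
      -- on `m` alone.
      extend (no m∤n) = subst (λ P → ((+ n) ^ suc m) ∈⟨ P , F b ⟩) (sym (∏∣-no F n m m∤n))
        (∈-*ˡ (+ n) IH)

    ∏∣-divides : ∀ m → m ℕ.< n → ∏∣ F n m ∣ (+ n) ^ triangle m * (x ^ n - 1ℤ)
    ∏∣-divides zero    _   = divides (1ℤ * (x ^ n - 1ℤ)) (sym (*-identityʳ _))
    ∏∣-divides (suc m) m<n = subst (∏∣ F n (suc m) ∣_)
      (trans (sym (*-assoc ((+ n) ^ m) T X)) (cong (_* X) (sym (^-distribˡ-+-* (+ n) m (triangle m)))))
      (extend (suc m ℕ.∣? n))
      where
      X  = x ^ n - 1ℤ
      T  = (+ n) ^ triangle m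
      IH : ∏∣ F n m ∣ T * X
      IH = ∏∣-divides m (ℕ.<-trans (ℕ.n<1+n m) m<n)
      extend : Dec (suc m ℕ.∣ n) → ∏∣ F n (suc m) ∣ (+ n) ^ m * (T * X)
      extend (yes m∣n) = subst (_∣ (+ n) ^ m * (T * X)) (sym (∏∣-yes F n m m∣n))
        (∈-divides (coprime-product m (ℕ.n<1+n m) m<n m∣n) IH
          (∣n⇒∣m*n T (∣-trans (F∣x^d-1 (suc m) (ℕ.s≤s ℕ.z≤n) m<n) (x^d-1∣x^n-1 x m∣n))))
      extend (no m∤n) = subst (_∣ (+ n) ^ m * (T * X)) (sym (∏∣-no F n m m∤n)) (∣n⇒∣m*n ((+ n) ^ m) IH)

  -- Degree and symmetry of Φ

  lookupΦ-init : ∀ ps q d → d ℕ.< length ps → lookupΦ (ps ++ [ q ]) (suc d) ≡ lookupΦ ps (suc d)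
  lookupΦ-init (p ∷ ps) q zero    _          = refl
  lookupΦ-init (p ∷ ps) q (suc d) (ℕ.s≤s lt) = lookupΦ-init ps q d lt

  lookupΦ-last : ∀ ps q → lookupΦ (ps ++ [ q ]) (suc (length ps)) ≡ q
  lookupΦ-last []       q = refl
  lookupΦ-last (p ∷ ps) q = lookupΦ-last ps q

  length-cycloTable : ∀ n → length (cycloTable n) ≡ n
  length-cycloTable zero    = refl
  length-cycloTable (suc n) = trans (length-++ (cycloTable n)) (trans (ℕ.+-comm _ 1) (cong suc (length-cycloTable n)))

  lookupΦ-cycloTable : ∀ n d → d ℕ.< n → lookupΦ (cycloTable n) (suc d) ≡ Φ (suc d)
  lookupΦ-cycloTable (suc n) d d<1+n with d ℕ.≟ n
  ... | yes refl = trans (cong (λ l → lookupΦ (cycloTable (suc n)) (suc l)) (sym (length-cycloTable n)))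
                         (lookupΦ-last (cycloTable n) (Φ (suc n)))
  ... | no d≢n   = trans (lookupΦ-init (cycloTable n) _ d (subst (d ℕ.<_) (sym (length-cycloTable n)) d<n))
                         (lookupΦ-cycloTable n d d<n)
    where d<n = ℕ.≤∧≢⇒< (ℕ.s≤s⁻¹ d<1+n) d≢n

  divisorsUpTo : ℕ → ℕ → List ℕ
  divisorsUpTo n m = filter (ℕ._∣? n) (applyUpTo suc m)

  ∏P : (ℕ → Poly) → List ℕ → Poly
  ∏P G = foldr (λ d acc → G d *P acc) [ 1ℤ ]

  divisorsUpTo-range : ∀ n m → All (λ d → 1 ℕ.≤ d × d ℕ.≤ m) (divisorsUpTo n m)
  divisorsUpTo-range n m = All.filter⁺ (ℕ._∣? n) (All.applyUpTo⁺₁ suc m λ i<m → ℕ.s≤s ℕ.z≤n , i<m)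

  ∏P-cong : ∀ {G H ds} → All (λ d → G d ≡ H d) ds → ∏P G ds ≡ ∏P H ds
  ∏P-cong []       = refl
  ∏P-cong (e ∷ es) = cong₂ _*P_ e (∏P-cong es)

  ∏P-monic : ∀ {G δ ds} → All (λ d → Monic (δ d) (G d)) ds → Monic (sum (map δ ds)) (∏P G ds)
  ∏P-monic []       = [] , refl , refl
  ∏P-monic (m ∷ ms) = *P-monic m (∏P-monic ms)

  -- Serves two evaluations: `ev`, and `evʳ`, whose product rule is stated for non-empty lists;
  -- monic lists are non-empty.
  ∏P-multiplicative : (h : Poly → ℤ) → h [ 1ℤ ] ≡ 1ℤ →
    (∀ {d e p q} → Monic d p → Monic e q → h (p *P q) ≡ h p * h q) →
    ∀ {G : ℕ → Poly} {δ : ℕ → ℕ} {ds} → All (λ d → Monic (δ d) (G d)) ds →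
    h (∏P G ds) ≡ foldr (λ d acc → h (G d) * acc) 1ℤ ds
  ∏P-multiplicative h h1 h* []       = h1
  ∏P-multiplicative h h1 h* (m ∷ ms) =
    trans (h* m (∏P-monic ms)) (cong (h _ *_) (∏P-multiplicative h h1 h* ms))

  divisorsUpTo-suc : ∀ n m → divisorsUpTo n (suc m) ≡ divisorsUpTo n m ++ filter (ℕ._∣? n) [ suc m ]
  divisorsUpTo-suc n m = trans (cong (filter (ℕ._∣? n)) (sym (applyUpTo-∷ʳ suc m))) (filter-++ (ℕ._∣? n) (applyUpTo suc m) [ suc m ])

  sum-divisors : ∀ δ n m → sum (map δ (divisorsUpTo n m)) ≡ ∑ m (λ d → ⟦ d ℕ.∣? n ⟧ ℕ.* δ d)
  sum-divisors δ n zero    = refl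
  sum-divisors δ n (suc m) = begin
    sum (map δ (divisorsUpTo n (suc m)))                              ≡⟨ cong (sum ∘ map δ) (divisorsUpTo-suc n m) ⟩
    sum (map δ (divisorsUpTo n m ++ filter (ℕ._∣? n) [ suc m ]))      ≡⟨ cong sum (map-++ δ (divisorsUpTo n m) _) ⟩
    sum (map δ (divisorsUpTo n m) ++ map δ (filter (ℕ._∣? n) [ suc m ])) ≡⟨ sum-++ (map δ (divisorsUpTo n m)) _ ⟩
    _                                                                 ≡⟨ cong₂ ℕ._+_ (sum-divisors δ n m) (last (suc m)) ⟩
    ∑ m _ ℕ.+ ⟦ suc m ℕ.∣? n ⟧ ℕ.* δ (suc m)                          ∎
    where
    last : ∀ d → sum (map δ (filter (ℕ._∣? n) [ d ])) ≡ ⟦ d ℕ.∣? n ⟧ ℕ.* δ d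
    last d with d ℕ.∣? n
    ... | yes _ = refl
    ... | no  _ = refl

  product-divisors : ∀ f n m → foldr (λ d acc → f d * acc) 1ℤ (divisorsUpTo n m) ≡ ∏∣ f n m
  product-divisors f n zero    = refl
  product-divisors f n (suc m) = begin
    prod (divisorsUpTo n (suc m))                                     ≡⟨ cong prod (divisorsUpTo-suc n m) ⟩
    prod (divisorsUpTo n m ++ filter (ℕ._∣? n) [ suc m ])             ≡⟨ prod-++ (divisorsUpTo n m) _ ⟩
    prod (divisorsUpTo n m) * prod (filter (ℕ._∣? n) [ suc m ])       ≡⟨ cong₂ _*_ (product-divisors f n m) (last (suc m)) ⟩
    ∏∣ f n m * divisorFactor f n (suc m)                              ∎
    where
    prod : List ℕ → ℤ
    prod = foldr (λ d acc → f d * acc) 1ℤ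
    prod-++ : ∀ ds es → prod (ds ++ es) ≡ prod ds * prod es
    prod-++ []       es = sym (*-identityˡ _)
    prod-++ (d ∷ ds) es = trans (cong (f d *_) (prod-++ ds es)) (sym (*-assoc (f d) (prod ds) (prod es)))
    last : ∀ d → prod (filter (ℕ._∣? n) [ d ]) ≡ divisorFactor f n d
    last d with d ℕ.∣? n
    ... | yes _ = *-identityʳ (f d)
    ... | no  _ = refl

  xPowMinusOne-suc : ∀ m → xPowMinusOne (suc m) ≡ (-1ℤ ∷ replicate m 0ℤ) ++ [ 1ℤ ]
  xPowMinusOne-suc m = cong (-1ℤ ∷_) (+P-identityʳ _)

  xPowMinusOne-monic : ∀ m → Monic (suc m) (xPowMinusOne (suc m))
  xPowMinusOne-monic m = -1ℤ ∷ replicate m 0ℤ , cong suc (length-replicate m) , xPowMinusOne-suc m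

  ev-xPowMinusOne : ∀ m x → ev (xPowMinusOne (suc m)) x ≡ x ^ suc m - 1ℤ
  ev-xPowMinusOne m x = begin
    ev (xPowMinusOne (suc m)) x                                   ≡⟨ cong (λ p → ev p x) (xPowMinusOne-suc m) ⟩
    -1ℤ + x * ev (replicate m 0ℤ ++ [ 1ℤ ]) x                     ≡⟨ cong (λ t → -1ℤ + x * t) (ev-∷ʳ (replicate m 0ℤ) 1ℤ x) ⟩
    -1ℤ + x * (ev (replicate m 0ℤ) x + 1ℤ * x ^ length (replicate m 0ℤ))
      ≡⟨ cong₂ (λ s l → -1ℤ + x * (s + 1ℤ * x ^ l)) (ev-replicate-0 m x) (length-replicate m) ⟩
    -1ℤ + x * (0ℤ + 1ℤ * x ^ m)                                   ≡⟨ regroup x (x ^ m) ⟩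
    x ^ suc m - 1ℤ                                                ∎
    where
    regroup : ∀ x y → -1ℤ + x * (0ℤ + 1ℤ * y) ≡ x * y - 1ℤ
    regroup = solve-∀

  evʳ-xPowMinusOne : ∀ m x → evʳ (xPowMinusOne (suc m)) x ≡ - (x ^ suc m - 1ℤ)
  evʳ-xPowMinusOne m x = begin
    evʳ (xPowMinusOne (suc m)) x                    ≡⟨ cong (λ p → evʳ p x) (xPowMinusOne-suc m) ⟩
    evʳ ((-1ℤ ∷ replicate m 0ℤ) ++ [ 1ℤ ]) x        ≡⟨ evʳ-∷ʳ (-1ℤ ∷ replicate m 0ℤ) 1ℤ x ⟩
    1ℤ + x * (-1ℤ * x ^ length (replicate m 0ℤ) + evʳ (replicate m 0ℤ) x)
      ≡⟨ cong₂ (λ s l → 1ℤ + x * (-1ℤ * x ^ l + s)) (zeros m) (length-replicate m) ⟩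
    1ℤ + x * (-1ℤ * x ^ m + 0ℤ)                     ≡⟨ regroup x (x ^ m) ⟩
    - (x ^ suc m - 1ℤ)                              ∎
    where
    zeros : ∀ m → evʳ (replicate m 0ℤ) x ≡ 0ℤ
    zeros zero    = refl
    zeros (suc m) = trans (+-identityˡ _) (zeros m)
    regroup : ∀ x y → 1ℤ + x * (-1ℤ * y + 0ℤ) ≡ - (x * y - 1ℤ)
    regroup = solve-∀

  x^g≢1 : ∀ x → 1 ℕ.< x → ∀ g → 1 ℕ.≤ g → (+ x) ^ g - 1ℤ ≢ 0ℤ
  x^g≢1 x@(suc _) 1<x g@(suc g′) _ eq = ℕ.<⇒≢ (ℕ.<-≤-trans 1<x (ℕ.m≤m*n x (x ℕ.^ g′) {{ℕ.m^n≢0 x g′}}))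
    (sym (+-injective (trans (pos-^ x g) (i-j≡0⇒i≡j ((+ x) ^ g) 1ℤ eq))))

  Φ-quotient : ∀ m → Φ (suc m) ≡ divMonic (xPowMinusOne (suc m)) (∏P Φ (divisorsUpTo (suc m) m))
  Φ-quotient m = trans (Φ-eq m) (cong (divMonic (xPowMinusOne (suc m)))
    (∏P-cong {lookupΦ (cycloTable m)} {Φ} (All.map (λ { {suc d} (_ , d<m) → lookupΦ-cycloTable m d d<m ; {zero} (() , _) }) (divisorsUpTo-range (suc m) m))))

  -- Both fields go through one induction: exactness of the division at n uses the degrees, to have
  -- a monic divisor, and the product formula at smaller indices, to have divisibility of values.
  record IsCyclotomic (n : ℕ) : Set where
    field
      monic      : Monic (φ n) (Φ n)
      factorised : ∀ x → ∏∣ (λ d → ev (Φ d) x) n n ≡ x ^ n - 1ℤ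
  open IsCyclotomic

  proper-degree : ∀ m → sum (map φ (divisorsUpTo (suc m) m)) ℕ.+ φ (suc m) ≡ suc m
  proper-degree m = begin
    sum (map φ (divisorsUpTo (suc m) m)) ℕ.+ φ (suc m) ≡⟨ cong₂ ℕ._+_ (sum-divisors φ (suc m) m) (sym (trans (cong (ℕ._* φ (suc m)) (⟦⟧-true (suc m ℕ.∣? suc m) ℕ.∣-refl)) (ℕ.*-identityˡ _))) ⟩
    ∑ (suc m) (λ d → ⟦ d ℕ.∣? suc m ⟧ ℕ.* φ d)         ≡⟨ ∑φ (suc m) ⟩
    suc m                                              ∎

  module _ (m : ℕ) (IH : ∀ {d} → d ℕ.< suc m → 1 ℕ.≤ d → IsCyclotomic d) where
    proper-monic : All (λ d → Monic (φ d) (Φ d)) (divisorsUpTo (suc m) m)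
    proper-monic = All.map (λ (1≤d , d≤m) → monic (IH (ℕ.s≤s d≤m) 1≤d)) (divisorsUpTo-range (suc m) m)

    proper-product-monic : Monic (sum (map φ (divisorsUpTo (suc m) m))) (∏P Φ (divisorsUpTo (suc m) m))
    proper-product-monic = ∏P-monic proper-monic

    ev-proper-product : ∀ x → ev (∏P Φ (divisorsUpTo (suc m) m)) x ≡ ∏∣ (λ d → ev (Φ d) x) (suc m) m
    ev-proper-product x = trans
      (∏P-multiplicative (λ p → ev p x) (cong (λ t → 1ℤ + t) (*-zeroʳ x)) (λ {_} {_} {p} {q} _ _ → ev-*P p q x) {δ = φ} proper-monic)
      (product-divisors (λ d → ev (Φ d) x) (suc m) m)

    -- The bound x > 1 keeps each xᵍ - 1 nonzero and so cancellable; the multiplier is the same for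
    -- all x, as `divMonic-exact` demands.
    proper-product-divides : ∀ x → 1 ℕ.< x →
      ev (∏P Φ (divisorsUpTo (suc m) m)) (+ x) ∣ + (suc m ℕ.^ triangle m) * ev (xPowMinusOne (suc m)) (+ x)
    proper-product-divides x 1<x = subst₂ _∣_ (sym (ev-proper-product (+ x)))
      (cong₂ _*_ (sym (pos-^ (suc m) (triangle m))) (sym (ev-xPowMinusOne m (+ x))))
      (CyclotomicValues.∏∣-divides (+ x) (x^g≢1 x 1<x) (λ d → ev (Φ d) (+ x)) (suc m)
        (λ d 1≤d d<n → factorised (IH d<n 1≤d) (+ x)) m (ℕ.n<1+n m))

    isCyclotomic-step : IsCyclotomic (suc m)
    isCyclotomic-step .monic = subst₂ Monic
      (trans (cong (ℕ._∸ s) (sym (proper-degree m))) (ℕ.m+n∸m≡n s _)) (sym (Φ-quotient m))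
      (divMonic-monic (xPowMinusOne-monic m) proper-product-monic (subst (s ℕ.≤_) (proper-degree m) (ℕ.m≤m+n s _)))
      where s = sum (map φ (divisorsUpTo (suc m) m))
    isCyclotomic-step .factorised x = begin
      ∏∣ F (suc m) (suc m)                               ≡⟨ ∏∣-yes F (suc m) m ℕ.∣-refl ⟩
      ∏∣ F (suc m) m * ev (Φ (suc m)) x                  ≡⟨ cong₂ _*_ (sym (ev-proper-product x)) (cong (λ p → ev p x) (Φ-quotient m)) ⟩
      ev B x * ev (divMonic (xPowMinusOne (suc m)) B) x  ≡⟨ *-comm (ev B x) _ ⟩
      ev (divMonic (xPowMinusOne (suc m)) B) x * ev B x  ≡⟨ divMonic-exact (xPowMinusOne (suc m)) B (suc m ℕ.^ triangle m) 1 {{ℕ.m^n≢0 (suc m) (triangle m)}} proper-product-monic proper-product-divides x ⟨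
      ev (xPowMinusOne (suc m)) x                        ≡⟨ ev-xPowMinusOne m x ⟩
      x ^ suc m - 1ℤ                                     ∎
      where
      F = λ d → ev (Φ d) x
      B = ∏P Φ (divisorsUpTo (suc m) m)

  isCyclotomic : ∀ n → 1 ℕ.≤ n → IsCyclotomic n
  isCyclotomic = <-rec _ λ { (suc m) IH _ → isCyclotomic-step m IH }

  length-Φ : ∀ n → 1 ℕ.≤ n → length (Φ n) ≡ suc (φ n)
  length-Φ n 1≤n = length-monic (monic (isCyclotomic n 1≤n))

  -- Reversed evaluation of sums and products

  length-+P : ∀ u v → length u ℕ.≤ length v → length (u +P v) ≡ length v
  length-+P []      v       _          = refl
  length-+P (a ∷ u) (b ∷ v) (ℕ.s≤s le) = cong suc (length-+P u v le)

  -- `+P` aligns constant terms whereas `evʳ` counts exponents from the other end; the list shorter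
  -- by `k` therefore acquires xᵏ.
  evʳ-+P : ∀ u v k x → k ℕ.+ length u ≡ length v → evʳ (u +P v) x ≡ x ^ k * evʳ u x + evʳ v x
  evʳ-+P []      v       k x _   = sym (trans (cong (_+ evʳ v x) (*-zeroʳ (x ^ k))) (+-identityˡ _))
  evʳ-+P (a ∷ u) []      k x len with () ← trans (sym (ℕ.+-suc k (length u))) len
  evʳ-+P (a ∷ u) (b ∷ v) k x len = begin
    (a + b) * x ^ length (u +P v) + evʳ (u +P v) x        ≡⟨ cong₂ (λ l t → (a + b) * x ^ l + t) (length-+P u v (subst (length u ℕ.≤_) len′ (ℕ.m≤n+m _ k))) (evʳ-+P u v k x len′) ⟩
    (a + b) * x ^ length v + (x ^ k * evʳ u x + evʳ v x)  ≡⟨ regroup a b (x ^ length v) (x ^ k * evʳ u x) (evʳ v x) ⟩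
    a * x ^ length v + x ^ k * evʳ u x + (b * x ^ length v + evʳ v x)
      ≡⟨ cong (λ t → a * t + x ^ k * evʳ u x + evʳ (b ∷ v) x) (trans (cong (x ^_) (sym len′)) (^-distribˡ-+-* x k (length u))) ⟩
    a * (x ^ k * x ^ length u) + x ^ k * evʳ u x + evʳ (b ∷ v) x ≡⟨ cong (_+ evʳ (b ∷ v) x) (factor a (x ^ k) (x ^ length u) (evʳ u x)) ⟩
    x ^ k * (a * x ^ length u + evʳ u x) + evʳ (b ∷ v) x  ∎
    where
    len′ : k ℕ.+ length u ≡ length v
    len′ = ℕ.suc-injective (trans (sym (ℕ.+-suc k (length u))) len)
    regroup : ∀ a b y s t → (a + b) * y + (s + t) ≡ a * y + s + (b * y + t)
    regroup = solve-∀
    factor : ∀ a y z s → a * (y * z) + y * s ≡ y * (a * z + s)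
    factor = solve-∀

  length-*P : ∀ a p b q → length ((a ∷ p) *P (b ∷ q)) ≡ length p ℕ.+ suc (length q)
  length-*P a []      b q = cong suc (trans (cong length (+P-identityʳ (map (a *_) q))) (length-map (a *_) q))
  length-*P a (c ∷ p) b q = trans
    (length-+P (map (a *_) (b ∷ q)) (0ℤ ∷ (c ∷ p) *P (b ∷ q))
      (subst₂ ℕ._≤_ (sym (length-map (a *_) (b ∷ q))) (cong suc (sym (length-*P c p b q))) (ℕ.m≤n⇒m≤1+n (ℕ.m≤n+m _ (length p)))))
    (cong suc (length-*P c p b q))

  evʳ-*P : ∀ a p b q x → evʳ ((a ∷ p) *P (b ∷ q)) x ≡ evʳ (a ∷ p) x * evʳ (b ∷ q) x
  evʳ-*P a []      b q x = begin
    evʳ (map (a *_) (b ∷ q) +P [ 0ℤ ]) x   ≡⟨ cong (λ p → evʳ p x) (cong₂ _∷_ (+-identityʳ (a * b)) (+P-identityʳ (map (a *_) q))) ⟩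
    evʳ (map (a *_) (b ∷ q)) x             ≡⟨ evʳ-map-* a (b ∷ q) x ⟩
    a * evʳ (b ∷ q) x                      ≡⟨ cong (_* evʳ (b ∷ q) x) (constant a) ⟩
    (a * 1ℤ + 0ℤ) * evʳ (b ∷ q) x          ∎
    where
    constant : ∀ a → a ≡ a * 1ℤ + 0ℤ
    constant = solve-∀
  evʳ-*P a (c ∷ p) b q x = begin
    evʳ (map (a *_) (b ∷ q) +P (0ℤ ∷ r)) x
      ≡⟨ evʳ-+P (map (a *_) (b ∷ q)) (0ℤ ∷ r) (suc (length p)) x (trans (cong (suc (length p) ℕ.+_) (length-map (a *_) (b ∷ q))) (cong suc (sym (length-*P c p b q)))) ⟩
    x ^ suc (length p) * evʳ (map (a *_) (b ∷ q)) x + (0ℤ * x ^ length r + evʳ r x)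
      ≡⟨ cong₂ (λ s t → x ^ suc (length p) * s + (0ℤ * x ^ length r + t)) (evʳ-map-* a (b ∷ q) x) (evʳ-*P c p b q x) ⟩
    x ^ suc (length p) * (a * evʳ (b ∷ q) x) + (0ℤ * x ^ length r + evʳ (c ∷ p) x * evʳ (b ∷ q) x)
      ≡⟨ regroup (x ^ suc (length p)) a (evʳ (b ∷ q) x) (x ^ length r) (evʳ (c ∷ p) x) ⟩
    (a * x ^ suc (length p) + evʳ (c ∷ p) x) * evʳ (b ∷ q) x ∎
    where
    r = (c ∷ p) *P (b ∷ q)
    regroup : ∀ y a s z t → y * (a * s) + (0ℤ * z + t * s) ≡ (a * y + t) * s
    regroup = solve-∀

  monic-nonempty : ∀ {d p} → Monic d p → ∃₂ λ a q → p ≡ a ∷ q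
  monic-nonempty ([]    , _ , eq) = _ , _ , eq
  monic-nonempty (_ ∷ _ , _ , eq) = _ , _ , eq

  evʳ-*P-monic : ∀ x {d e p q} → Monic d p → Monic e q → evʳ (p *P q) x ≡ evʳ p x * evʳ q x
  evʳ-*P-monic x mp mq with monic-nonempty mp | monic-nonempty mq
  ... | a , p , refl | b , q , refl = evʳ-*P a p b q x

  -- Φ 1 = x − 1 is the only anti-palindromic factor.
  ∏∣-sign : ∀ (F G : ℕ → ℤ) n m → F 1 ≡ - G 1 → (∀ d → 2 ℕ.≤ d → d ℕ.≤ suc m → F d ≡ G d) →
    ∏∣ F n (suc m) ≡ - ∏∣ G n (suc m)
  ∏∣-sign F G n zero    h₁ h = begin
    ∏∣ F n 1        ≡⟨ ∏∣-yes F n 0 (ℕ.1∣ n) ⟩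
    1ℤ * F 1        ≡⟨ cong (1ℤ *_) h₁ ⟩
    1ℤ * - G 1      ≡⟨ neg-distribʳ-* 1ℤ (G 1) ⟨
    - (1ℤ * G 1)    ≡⟨ cong -_ (∏∣-yes G n 0 (ℕ.1∣ n)) ⟨
    - ∏∣ G n 1      ∎
  ∏∣-sign F G n (suc m) h₁ h = trans
    (cong₂ _*_ (∏∣-sign F G n m h₁ λ d 2≤d d≤m → h d 2≤d (ℕ.m≤n⇒m≤1+n d≤m))
      (cong (if does (suc (suc m) ℕ.∣? n) then_else 1ℤ) (h (suc (suc m)) (ℕ.s≤s (ℕ.s≤s ℕ.z≤n)) ℕ.≤-refl)))
    (sym (neg-distribˡ-* (∏∣ G n (suc m)) (divisorFactor G n (suc (suc m)))))

  evʳ-Φ₁ : ∀ x → evʳ (Φ 1) x ≡ - ev (Φ 1) x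
  evʳ-Φ₁ = expand
    where
    expand : ∀ x → -1ℤ * (x * 1ℤ) + (1ℤ * 1ℤ + 0ℤ) ≡ - (-1ℤ + x * (1ℤ + x * 0ℤ))
    expand = solve-∀

  -- Apply `evʳ` to Φₙ · B = xⁿ - 1, where B is the product over the proper divisors. The right side
  -- changes sign, and so does B: its factor Φ₁ does, and the others are palindromic by induction.
  -- Cancelling B(y), nonzero for y > 1, gives equal values of Φₙ and its reversal.
  Φ-palindromic : ∀ n → 2 ℕ.≤ n → reverse (Φ n) ≡ Φ n
  Φ-palindromic = <-rec _ step
    where
    step : ∀ n → (∀ {d} → d ℕ.< n → 2 ℕ.≤ d → reverse (Φ d) ≡ Φ d) → 2 ℕ.≤ n → reverse (Φ n) ≡ Φ n
    step (suc zero) _ (ℕ.s≤s ())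
    step n@(suc m@(suc m′)) IH _ = ev-injective 1 (reverse (Φ n)) (Φ n) (length-reverse (Φ n)) λ y 1<y →
      trans (ev-reverse (Φ n) (+ y)) (agree y 1<y)
      where
      B = ∏P Φ (divisorsUpTo n m)
      cyclotomic : ∀ {d} → d ℕ.< n → 1 ℕ.≤ d → IsCyclotomic d
      cyclotomic {d} _ = isCyclotomic d
      Φ-monic = monic (isCyclotomic n (ℕ.s≤s ℕ.z≤n))
      B-monic = proper-product-monic m cyclotomic

      values : ∀ x → ev (Φ n) x * ∏∣ (λ d → ev (Φ d) x) n m ≡ x ^ n - 1ℤ
      values x = trans (*-comm (ev (Φ n) x) _)
        (trans (sym (∏∣-yes (λ d → ev (Φ d) x) n m ℕ.∣-refl)) (factorised (isCyclotomic n (ℕ.s≤s ℕ.z≤n)) x))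

      -- Equality of lists is needed here: `evʳ` depends on the length of a list, so equal values
      -- under `ev` would not suffice.
      Φ*B : Φ n *P B ≡ xPowMinusOne n
      Φ*B = ev-injective 0 (Φ n *P B) (xPowMinusOne n)
        (trans (length-monic (*P-monic Φ-monic B-monic))
          (trans (cong suc (trans (ℕ.+-comm (φ n) _) (proper-degree m))) (sym (length-monic (xPowMinusOne-monic m)))))
        λ y _ → trans (ev-*P (Φ n) B (+ y)) (trans (cong (ev (Φ n) (+ y) *_) (ev-proper-product m cyclotomic (+ y)))
          (trans (values (+ y)) (sym (ev-xPowMinusOne m (+ y)))))

      evʳ-B : ∀ x → evʳ B x ≡ - ∏∣ (λ d → ev (Φ d) x) n m
      evʳ-B x = begin
        evʳ B x                               ≡⟨ ∏P-multiplicative (λ p → evʳ p x) refl (evʳ-*P-monic x) {δ = φ} (proper-monic m cyclotomic) ⟩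
        _                                     ≡⟨ product-divisors (λ d → evʳ (Φ d) x) n m ⟩
        ∏∣ (λ d → evʳ (Φ d) x) n m            ≡⟨ ∏∣-sign (λ d → evʳ (Φ d) x) (λ d → ev (Φ d) x) n m′ (evʳ-Φ₁ x)
                                                   (λ d 2≤d d≤m → trans (sym (ev-reverse (Φ d) x)) (cong (λ p → ev p x) (IH (ℕ.s≤s d≤m) 2≤d))) ⟩
        - ∏∣ (λ d → ev (Φ d) x) n m           ∎

      agree : ∀ y → 1 ℕ.< y → evʳ (Φ n) (+ y) ≡ ev (Φ n) (+ y)
      agree y 1<y = *-cancelʳ-≡ _ _ P {{≢-nonZero P≢0}} (neg-injective (begin
        - (evʳ (Φ n) (+ y) * P)        ≡⟨ neg-distribʳ-* (evʳ (Φ n) (+ y)) P ⟩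
        evʳ (Φ n) (+ y) * - P          ≡⟨ cong (evʳ (Φ n) (+ y) *_) (evʳ-B (+ y)) ⟨
        evʳ (Φ n) (+ y) * evʳ B (+ y)  ≡⟨ evʳ-*P-monic (+ y) Φ-monic B-monic ⟨
        evʳ (Φ n *P B) (+ y)           ≡⟨ cong (λ p → evʳ p (+ y)) Φ*B ⟩
        evʳ (xPowMinusOne n) (+ y)     ≡⟨ evʳ-xPowMinusOne m (+ y) ⟩
        - ((+ y) ^ n - 1ℤ)             ≡⟨ cong -_ (values (+ y)) ⟨
        - (ev (Φ n) (+ y) * P)         ∎))
        where
        P = ∏∣ (λ d → ev (Φ d) (+ y)) n m
        P≢0 : P ≢ 0ℤ
        P≢0 P≡0 = x^g≢1 y 1<y n (ℕ.s≤s ℕ.z≤n)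
          (trans (sym (values (+ y))) (trans (cong (ev (Φ n) (+ y) *_) P≡0) (*-zeroʳ (ev (Φ n) (+ y)))))

  -- Derivatives at 1 of palindromic polynomials

  fallingFactorial : ℤ → ℕ → ℤ
  fallingFactorial z zero    = 1ℤ
  fallingFactorial z (suc m) = z * fallingFactorial (z - 1ℤ) m

  -- A linear functional on coefficients. Differentiation is moved from the list to `w`, which
  -- leaves the list itself, and its symmetry, intact.
  weighted : (ℕ → ℤ) → Poly → ℤ
  weighted w []      = 0ℤ
  weighted w (c ∷ p) = c * w 0 + weighted (w ∘ suc) p

  weighted-cong : ∀ {u w} → (∀ j → u j ≡ w j) → ∀ p → weighted u p ≡ weighted w p
  weighted-cong h []      = refl
  weighted-cong h (c ∷ p) = cong₂ (λ s t → c * s + t) (h 0) (weighted-cong (h ∘ suc) p)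

  weighted-* : ∀ k w p → weighted (λ j → k * w j) p ≡ k * weighted w p
  weighted-* k w []      = sym (*-zeroʳ k)
  weighted-* k w (c ∷ p) = trans (cong (λ t → c * (k * w 0) + t) (weighted-* k (w ∘ suc) p)) (regroup c k (w 0) _)
    where
    regroup : ∀ c k u t → c * (k * u) + k * t ≡ k * (c * u + t)
    regroup = solve-∀

  weighted-∷ʳ : ∀ w p b → weighted w (p ∷ʳ b) ≡ weighted w p + b * w (length p)
  weighted-∷ʳ w []      b = +-comm (b * w 0) 0ℤ
  weighted-∷ʳ w (c ∷ p) b = trans (cong (λ t → c * w 0 + t) (weighted-∷ʳ (w ∘ suc) p b)) (sym (+-assoc (c * w 0) _ _))

  evalAt1-weighted : ∀ p → evalAt1 p ≡ weighted (λ _ → 1ℤ) p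
  evalAt1-weighted []      = refl
  evalAt1-weighted (c ∷ p) = cong₂ _+_ (sym (*-identityʳ c)) (evalAt1-weighted p)

  -- The transpose of differentiation.
  shiftWeight : (ℕ → ℤ) → ℕ → ℤ
  shiftWeight w zero    = 0ℤ
  shiftWeight w (suc j) = + suc j * w j

  weighted-derivAux : ∀ k w p → weighted w (derivAux k p) ≡ weighted (λ j → + (k ℕ.+ j) * w j) p
  weighted-derivAux k w []      = refl
  weighted-derivAux k w (c ∷ p) = cong₂ _+_
    (trans (cong (λ l → + l * c * w 0) (sym (ℕ.+-identityʳ k))) (regroup (+ (k ℕ.+ 0)) c (w 0)))
    (trans (weighted-derivAux (suc k) (w ∘ suc) p) (weighted-cong (λ j → cong (λ l → + l * w (suc j)) (sym (ℕ.+-suc k j))) p))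
    where
    regroup : ∀ k c u → k * c * u ≡ c * (k * u)
    regroup = solve-∀

  weighted-deriv : ∀ w p → weighted w (deriv p) ≡ weighted (shiftWeight w) p
  weighted-deriv w []      = refl
  weighted-deriv w (c ∷ p) = trans (weighted-derivAux 1 w p) (sym (trans (cong (_+ weighted (shiftWeight w ∘ suc) p) (*-zeroʳ c)) (+-identityˡ _)))

  shiftWeightN : ℕ → (ℕ → ℤ) → ℕ → ℤ
  shiftWeightN zero    w = w
  shiftWeightN (suc m) w = shiftWeightN m (shiftWeight w)

  weighted-derivN : ∀ m w p → weighted w (derivN m p) ≡ weighted (shiftWeightN m w) p
  weighted-derivN zero    w p = refl
  weighted-derivN (suc m) w p = trans (weighted-deriv w (derivN m p)) (weighted-derivN m (shiftWeight w) p)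

  shiftWeightN-suc : ∀ m w → shiftWeightN (suc m) w ≡ shiftWeight (shiftWeightN m w)
  shiftWeightN-suc zero    w = refl
  shiftWeightN-suc (suc m) w = shiftWeightN-suc m (shiftWeight w)

  shiftWeightN-1 : ∀ m j → shiftWeightN m (λ _ → 1ℤ) j ≡ fallingFactorial (+ j) m
  shiftWeightN-1 zero    j       = refl
  shiftWeightN-1 (suc m) zero    = cong (λ w → w 0) (shiftWeightN-suc m (λ _ → 1ℤ))
  shiftWeightN-1 (suc m) (suc j) = trans (cong (λ w → w (suc j)) (shiftWeightN-suc m (λ _ → 1ℤ))) (cong (+ suc j *_) (shiftWeightN-1 m j))

  evalAt1-derivN : ∀ m p → evalAt1 (derivN m p) ≡ weighted (λ j → fallingFactorial (+ j) m) p
  evalAt1-derivN m p = trans (evalAt1-weighted (derivN m p)) (trans (weighted-derivN m (λ _ → 1ℤ) p) (weighted-cong (shiftWeightN-1 m) p))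

  -- Equal coefficients sit at indices with i + j = d and together contribute a multiple of
  -- `w i + w j`; for even `d` the index d/2 has no partner.
  weighted-palindrome : ∀ {D} d w → (∀ i j → i ℕ.+ j ≡ d → D ∣ w i + w j) → (∀ e → e ℕ.+ e ≡ d → D ∣ w e) →
    ∀ p → reverse p ≡ p → length p ≡ suc d → D ∣ weighted w p
  weighted-palindrome {D} d w pairs middle p pal len = go (length p) 0 p ℕ.≤-refl pal len
    where
    -- Strips equal end entries; s counts the entries removed from each end, and l bounds the recursion.
    go : ∀ l s p → length p ℕ.≤ l → reverse p ≡ p → s ℕ.+ s ℕ.+ length p ≡ suc d → D ∣ weighted (λ j → w (s ℕ.+ j)) p
    go l       s []      _          _   _   = divides 0ℤ refl
    go (suc l) s (a ∷ r) (ℕ.s≤s le) pal len with initLast r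
    ... | []       = ∣m∣n⇒∣m+n (∣n⇒∣m*n a (subst (λ e → D ∣ w e) (sym (ℕ.+-identityʳ s)) (middle s s+s≡d))) (divides 0ℤ refl)
      where s+s≡d = ℕ.suc-injective (trans (ℕ.+-comm 1 (s ℕ.+ s)) len)
    ... | q ∷ʳ′ b = subst (D ∣_) (sym total) (∣m∣n⇒∣m+n
        (∣n⇒∣m*n a (pairs (s ℕ.+ 0) (s ℕ.+ suc (length q)) s+s+1+q≡d))
        (go l (suc s) q (ℕ.≤-trans (ℕ.≤-trans (ℕ.m≤m+n (length q) 1) (ℕ.≤-reflexive (sym (length-++ q)))) le) q-pal
          (trans (regroup s (length q)) len′)))
      where
      ends : b ∷ (reverse q ∷ʳ a) ≡ a ∷ (q ∷ʳ b)
      ends = trans (sym (trans (unfold-reverse a (q ∷ʳ b)) (cong (_∷ʳ a) (reverse-++ q [ b ])))) pal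
      b≡a : b ≡ a
      b≡a with e , _ ← ∷-injective ends = e
      q-pal : reverse q ≡ q
      q-pal with _ , e ← ∷-injective ends with e′ , _ ← ∷ʳ-injective (reverse q) q e = e′
      len′ : s ℕ.+ s ℕ.+ suc (length q ℕ.+ 1) ≡ suc d
      len′ = trans (cong (λ l → s ℕ.+ s ℕ.+ suc l) (sym (length-++ q))) len
      regroup : ∀ s l → suc s ℕ.+ suc s ℕ.+ l ≡ s ℕ.+ s ℕ.+ suc (l ℕ.+ 1)
      regroup = ℕ.solve-∀
      regroup′ : ∀ s l → suc (s ℕ.+ 0 ℕ.+ (s ℕ.+ suc l)) ≡ s ℕ.+ s ℕ.+ suc (l ℕ.+ 1)
      regroup′ = ℕ.solve-∀
      s+s+1+q≡d : s ℕ.+ 0 ℕ.+ (s ℕ.+ suc (length q)) ≡ d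
      s+s+1+q≡d = ℕ.suc-injective (trans (regroup′ s (length q)) len′)
      collect : ∀ a u v t → a * u + (t + a * v) ≡ a * (u + v) + t
      collect = solve-∀
      W = weighted (λ j → w (suc s ℕ.+ j)) q
      total : weighted (λ j → w (s ℕ.+ j)) (a ∷ q ∷ʳ b) ≡ a * (w (s ℕ.+ 0) + w (s ℕ.+ suc (length q))) + W
      total = begin
        a * w (s ℕ.+ 0) + weighted (λ j → w (s ℕ.+ suc j)) (q ∷ʳ b)
          ≡⟨ cong (λ t → a * w (s ℕ.+ 0) + t) (weighted-∷ʳ (λ j → w (s ℕ.+ suc j)) q b) ⟩
        a * w (s ℕ.+ 0) + (weighted (λ j → w (s ℕ.+ suc j)) q + b * w (s ℕ.+ suc (length q)))
          ≡⟨ cong₂ (λ t c → a * w (s ℕ.+ 0) + (t + c * w (s ℕ.+ suc (length q))))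
               (weighted-cong (λ j → cong w (ℕ.+-suc s j)) q) b≡a ⟩
        a * w (s ℕ.+ 0) + (W + a * w (s ℕ.+ suc (length q)))
          ≡⟨ collect a (w (s ℕ.+ 0)) (w (s ℕ.+ suc (length q))) W ⟩
        a * (w (s ℕ.+ 0) + w (s ℕ.+ suc (length q))) + W ∎

  -- Congruences for falling factorials

  fallingFactorial-+ : ∀ z m n → fallingFactorial z (m ℕ.+ n) ≡ fallingFactorial z m * fallingFactorial (z - + m) n
  fallingFactorial-+ z zero    n = trans (cong (λ y → fallingFactorial y n) (sym (+-identityʳ z))) (sym (*-identityˡ _))
  fallingFactorial-+ z (suc m) n = begin
    z * fallingFactorial (z - 1ℤ) (m ℕ.+ n)                                    ≡⟨ cong (z *_) (fallingFactorial-+ (z - 1ℤ) m n) ⟩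
    z * (fallingFactorial (z - 1ℤ) m * fallingFactorial (z - 1ℤ - + m) n)      ≡⟨ *-assoc z _ _ ⟨
    z * fallingFactorial (z - 1ℤ) m * fallingFactorial (z - 1ℤ - + m) n        ≡⟨ cong (λ y → z * fallingFactorial (z - 1ℤ) m * fallingFactorial y n) (regroup z (+ m)) ⟩
    z * fallingFactorial (z - 1ℤ) m * fallingFactorial (z - + suc m) n         ∎
    where
    regroup : ∀ z m → z - 1ℤ - m ≡ z - (1ℤ + m)
    regroup = solve-∀

  fallingFactorial-∣ : ∀ {D} a b m → D ∣ a - b → D ∣ fallingFactorial a m - fallingFactorial b m
  fallingFactorial-∣ a b zero    h = divides 0ℤ refl
  fallingFactorial-∣ {D} a b (suc m) h = subst (D ∣_) (expand a b (fallingFactorial (a - 1ℤ) m) (fallingFactorial (b - 1ℤ) m))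
    (∣m∣n⇒∣m+n (∣m⇒∣m*n (fallingFactorial (a - 1ℤ) m) h)
      (∣n⇒∣m*n b (fallingFactorial-∣ (a - 1ℤ) (b - 1ℤ) m (subst (D ∣_) (shift a b) h))))
    where
    expand : ∀ a b s t → (a - b) * s + b * (s - t) ≡ a * s - b * t
    expand = solve-∀
    shift : ∀ a b → a - b ≡ a - 1ℤ - (b - 1ℤ)
    shift = solve-∀

  -- The factors m - z, ..., 1 - z, -z are the negatives of z, z - 1, ..., z - m in reverse order.
  fallingFactorial-reflect : ∀ m z → fallingFactorial (+ m - z) (suc m) ≡ -1ℤ ^ suc m * fallingFactorial z (suc m)
  fallingFactorial-reflect zero    z = base z
    where
    base : ∀ z → (0ℤ - z) * 1ℤ ≡ -1ℤ * 1ℤ * (z * 1ℤ)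
    base = solve-∀
  fallingFactorial-reflect (suc m) z = begin
    (+ suc m - z) * fallingFactorial (+ suc m - z - 1ℤ) (suc m)                ≡⟨ cong (λ y → (+ suc m - z) * fallingFactorial y (suc m)) (shift (+ m) z) ⟩
    (+ suc m - z) * fallingFactorial (+ m - z) (suc m)                         ≡⟨ cong ((+ suc m - z) *_) (fallingFactorial-reflect m z) ⟩
    (+ suc m - z) * (-1ℤ ^ suc m * fallingFactorial z (suc m))                 ≡⟨ collect (+ suc m) z (-1ℤ ^ suc m) (fallingFactorial z (suc m)) ⟩
    -1ℤ * -1ℤ ^ suc m * (fallingFactorial z (suc m) * ((z - + suc m) * 1ℤ))    ≡⟨ cong (-1ℤ * -1ℤ ^ suc m *_) (fallingFactorial-+ z (suc m) 1) ⟨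
    -1ℤ * -1ℤ ^ suc m * fallingFactorial z (suc m ℕ.+ 1)                       ≡⟨ cong (λ l → -1ℤ * -1ℤ ^ suc m * fallingFactorial z l) (ℕ.+-comm (suc m) 1) ⟩
    -1ℤ ^ suc (suc m) * fallingFactorial z (suc (suc m))                       ∎
    where
    shift : ∀ m z → 1ℤ + m - z - 1ℤ ≡ m - z
    shift = solve-∀
    collect : ∀ m z s f → (m - z) * (s * f) ≡ -1ℤ * s * (f * ((z - m) * 1ℤ))
    collect = solve-∀

  -1^odd : ∀ k → -1ℤ ^ suc (2 ℕ.* k) ≡ -1ℤ
  -1^odd k = cong (-1ℤ *_) (trans (sym (^-*-assoc -1ℤ 2 k)) (^-zeroˡ k))

  -- Modulo d − 2k the index i = d − j is 2k − j, so the two falling factorials cancel by reflection.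
  fallingFactorial-pair : ∀ k i j d → i ℕ.+ j ≡ d →
    + d - + (2 ℕ.* k) ∣ fallingFactorial (+ i) (suc (2 ℕ.* k)) + fallingFactorial (+ j) (suc (2 ℕ.* k))
  fallingFactorial-pair k i j d refl = subst (D ∣_) (begin
      ff (+ i) - ff (+ (2 ℕ.* k) - + j)          ≡⟨ cong (λ t → ff (+ i) - t) (trans (fallingFactorial-reflect (2 ℕ.* k) (+ j)) (cong (_* ff (+ j)) (-1^odd k))) ⟩
      ff (+ i) - -1ℤ * ff (+ j)                  ≡⟨ double-negation (ff (+ i)) (ff (+ j)) ⟩
      ff (+ i) + ff (+ j)                        ∎)
    (fallingFactorial-∣ (+ i) (+ (2 ℕ.* k) - + j) (suc (2 ℕ.* k)) (∣-reflexive (difference (+ i) (+ j) (+ (2 ℕ.* k)))))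
    where
    D = + (i ℕ.+ j) - + (2 ℕ.* k)
    ff = λ z → fallingFactorial z (suc (2 ℕ.* k))
    double-negation : ∀ a b → a - -1ℤ * b ≡ a + b
    double-negation = solve-∀
    difference : ∀ i j l → i + j - l ≡ i - (l - j)
    difference = solve-∀

  consecutive-even : ∀ z → ∃ λ h → z * (z - 1ℤ) ≡ h * + 2
  consecutive-even z = from-remainder (z %ℕ 2) (z /ℕ 2) (a≡a%ℕn+[a/ℕn]*n z 2) (n%ℕd<d z 2)
    where
    even : ∀ q → (0ℤ + q * + 2) * (0ℤ + q * + 2 - 1ℤ) ≡ q * (q * + 2 - 1ℤ) * + 2
    even = solve-∀
    odd : ∀ q → (1ℤ + q * + 2) * (1ℤ + q * + 2 - 1ℤ) ≡ (1ℤ + q * + 2) * q * + 2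
    odd = solve-∀
    from-remainder : ∀ r q → z ≡ + r + q * + 2 → r ℕ.< 2 → ∃ λ h → z * (z - 1ℤ) ≡ h * + 2
    from-remainder 0 q refl _ = q * (q * + 2 - 1ℤ) , even q
    from-remainder 1 q refl _ = (1ℤ + q * + 2) * q , odd q
    from-remainder (suc (suc _)) q _ (ℕ.s≤s (ℕ.s≤s ()))

  -- The factor e − k supplies half of d − 2k; the two factors just above it supply the 2.
  fallingFactorial-middle : ∀ k e d → 2 ℕ.≤ k → e ℕ.+ e ≡ d →
    + d - + (2 ℕ.* k) ∣ fallingFactorial (+ e) (suc (2 ℕ.* k))
  fallingFactorial-middle k@(suc (suc k′)) e d (ℕ.s≤s (ℕ.s≤s _)) refl with consecutive-even (+ e - + k′)
  ... | h , eh = divides (fallingFactorial (+ e) k′ * h * rest) (begin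
    fallingFactorial (+ e) (suc (2 ℕ.* k))                                       ≡⟨ cong (fallingFactorial (+ e)) (regroup k′) ⟩
    fallingFactorial (+ e) (k′ ℕ.+ (2 ℕ.+ suc k))                                ≡⟨ fallingFactorial-+ (+ e) k′ (2 ℕ.+ suc k) ⟩
    fallingFactorial (+ e) k′ * (z * ((z - 1ℤ) * ((z - 1ℤ - 1ℤ) * rest)))        ≡⟨ collect (fallingFactorial (+ e) k′) z rest ⟩
    fallingFactorial (+ e) k′ * (z * (z - 1ℤ)) * rest * (z - 1ℤ - 1ℤ)            ≡⟨ cong (λ t → fallingFactorial (+ e) k′ * t * rest * (z - 1ℤ - 1ℤ)) eh ⟩
    fallingFactorial (+ e) k′ * (h * + 2) * rest * (z - 1ℤ - 1ℤ)                 ≡⟨ collect′ (fallingFactorial (+ e) k′) h rest (+ e) (+ k′) ⟩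
    fallingFactorial (+ e) k′ * h * rest * (+ e + + e - + 2 * (+ 2 + + k′))      ≡⟨ cong (λ t → fallingFactorial (+ e) k′ * h * rest * (+ e + + e - t)) (pos-* 2 k) ⟨
    fallingFactorial (+ e) k′ * h * rest * (+ (e ℕ.+ e) - + (2 ℕ.* k))           ∎)
    where
    z = + e - + k′
    rest = fallingFactorial (z - 1ℤ - 1ℤ - 1ℤ) k
    regroup : ∀ k → suc (2 ℕ.* (2 ℕ.+ k)) ≡ k ℕ.+ (2 ℕ.+ suc (2 ℕ.+ k))
    regroup = ℕ.solve-∀
    collect : ∀ a z r → a * (z * ((z - 1ℤ) * ((z - 1ℤ - 1ℤ) * r))) ≡ a * (z * (z - 1ℤ)) * r * (z - 1ℤ - 1ℤ)
    collect = solve-∀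
    collect′ : ∀ a h r e k → a * (h * + 2) * r * (e - k - 1ℤ - 1ℤ) ≡ a * h * r * (e + e - + 2 * (+ 2 + k))
    collect′ = solve-∀

  -- Here e = 2t. This 2 and the factor e - 1 make up d - 2, leaving the cofactor t(e - 2).
  fallingFactorial-middle₃ : ∀ e d → 4 ℕ.∣ d → e ℕ.+ e ≡ d → + d - + 2 ∣ fallingFactorial (+ e) 3
  fallingFactorial-middle₃ e d (ℕ.divides t d≡4t) refl = divides (+ t * (+ e - + 2)) (begin
    + e * ((+ e - 1ℤ) * ((+ e - 1ℤ - 1ℤ) * 1ℤ))                        ≡⟨ cong (_* ((+ e - 1ℤ) * ((+ e - 1ℤ - 1ℤ) * 1ℤ))) +e≡ ⟩
    + t * + 2 * ((+ e - 1ℤ) * ((+ e - 1ℤ - 1ℤ) * 1ℤ))                  ≡⟨ collect (+ t) (+ e) ⟩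
    + t * (+ e - + 2) * (+ (e ℕ.+ e) - + 2)                            ∎)
    where
    halve : ∀ e → 2 ℕ.* e ≡ e ℕ.+ e
    halve = ℕ.solve-∀
    double : ∀ t → t ℕ.* 4 ≡ 2 ℕ.* (t ℕ.* 2)
    double = ℕ.solve-∀
    +e≡ : + e ≡ + t * + 2
    +e≡ = trans (cong +_ (ℕ.*-cancelˡ-≡ e (t ℕ.* 2) 2 (trans (halve e) (trans d≡4t (double t))))) (pos-* t 2)
    collect : ∀ t e → t * + 2 * ((e - 1ℤ) * ((e - 1ℤ - 1ℤ) * 1ℤ)) ≡ t * (e - + 2) * (e + e - + 2)
    collect = solve-∀

  -- Odd derivatives of Φ at 1

  module _ (n : ℕ) (2≤n : 2 ℕ.≤ n) where
    weighted-Φ : ∀ {D} w → (∀ i j → i ℕ.+ j ≡ φ n → D ∣ w i + w j) → (∀ e → e ℕ.+ e ≡ φ n → D ∣ w e) → D ∣ weighted w (Φ n)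
    weighted-Φ w pairs middle = weighted-palindrome (φ n) w pairs middle (Φ n) (Φ-palindromic n 2≤n) (length-Φ n (ℕ.<⇒≤ 2≤n))

    -- Doubling turns the middle weight into a mirror pair with i = j = e, so no parity condition
    -- arises.
    Φ′′′-doubled : + φ n - + 2 ∣ + 2 * ΦDerivAt1 n 3
    Φ′′′-doubled = subst (+ φ n - + 2 ∣_)
      (trans (weighted-* (+ 2) (λ j → fallingFactorial (+ j) 3) (Φ n)) (cong (+ 2 *_) (sym (evalAt1-derivN 3 (Φ n)))))
      (weighted-Φ (λ j → + 2 * fallingFactorial (+ j) 3)
        (λ i j i+j≡d → subst (+ φ n - + 2 ∣_) (*-distribˡ-+ (+ 2) (fallingFactorial (+ i) 3) (fallingFactorial (+ j) 3))
          (∣n⇒∣m*n (+ 2) (fallingFactorial-pair 1 i j (φ n) i+j≡d)))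
        (λ e e+e≡d → subst (+ φ n - + 2 ∣_) (twice (fallingFactorial (+ e) 3)) (fallingFactorial-pair 1 e e (φ n) e+e≡d)))
      where
      twice : ∀ a → a + a ≡ + 2 * a
      twice = solve-∀

    Φ′′′ : 4 ℕ.∣ φ n → + φ n - + 2 ∣ ΦDerivAt1 n 3
    Φ′′′ 4∣φ = subst (+ φ n - + 2 ∣_) (sym (evalAt1-derivN 3 (Φ n)))
      (weighted-Φ (λ j → fallingFactorial (+ j) 3) (λ i j → fallingFactorial-pair 1 i j (φ n)) (λ e → fallingFactorial-middle₃ e (φ n) 4∣φ))

    Φ-odd-derivative : ∀ k → 2 ℕ.≤ k → + φ n - + (2 ℕ.* k) ∣ ΦDerivAt1 n (2 ℕ.* k ℕ.+ 1)
    Φ-odd-derivative k 2≤k = subst (+ φ n - + (2 ℕ.* k) ∣_)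
      (trans (sym (evalAt1-derivN (suc (2 ℕ.* k)) (Φ n))) (cong (ΦDerivAt1 n) (ℕ.+-comm 1 (2 ℕ.* k))))
      (weighted-Φ (λ j → fallingFactorial (+ j) (suc (2 ℕ.* k)))
        (λ i j → fallingFactorial-pair k i j (φ n)) (λ e → fallingFactorial-middle k e (φ n) 2≤k))

  Φ₁-derivatives : ∀ m → 2 ℕ.≤ m → ΦDerivAt1 1 m ≡ 0ℤ
  Φ₁-derivatives (suc (suc m)) (ℕ.s≤s (ℕ.s≤s _)) = cong evalAt1 (vanish m)
    where
    vanish : ∀ m → derivN (suc (suc m)) (Φ 1) ≡ []
    vanish zero    = refl
    vanish (suc m) = cong deriv (vanish m)

open import Data.Nat using (ℕ; suc; _≤_; z≤n; s≤s; _*_; _+_)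
open import Data.Nat.Properties using (≤-trans; m≤n*m; m≤n⇒m≤n+o)
open import Data.Nat.Divisibility using (_∣0) renaming (_∣_ to _∣ℕ_)
open import Data.Integer using (+_; _-_) renaming (_*_ to _*ℤ_)
open import Data.Integer.Divisibility using (_∣_)
open import Data.Integer.Divisibility.Signed using (∣⇒∣ᵤ)
open import Data.Product using (_×_; _,_)
open import Relation.Binary.PropositionalEquality using (subst; sym)
open Cyclotomic using (Φ₁-derivatives; Φ′′′-doubled; Φ′′′; Φ-odd-derivative)

theorem2p7 : (n : ℕ) → 1 ≤ n →
    (((+ φ n) - (+ 2)) ∣ ((+ 2) *ℤ ΦDerivAt1 n 3)
    × (4 ∣ℕ φ n → ((+ φ n) - (+ 2)) ∣ ΦDerivAt1 n 3))
    × ((k : ℕ) → 2 ≤ k → ((+ φ n) - (+ (2 * k))) ∣ ΦDerivAt1 n (2 * k + 1))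
theorem2p7 1 _ =
    -- Divisibility here compares absolute values: |φ(1) - 2| = 1, and the third derivative of x - 1
    -- is 0.
    (1 ∣0 , λ _ → 1 ∣0)
  , λ k 2≤k → subst ((+ φ 1 - + (2 * k)) ∣_) (sym (Φ₁-derivatives (2 * k + 1) (m≤n⇒m≤n+o 1 (≤-trans 2≤k (m≤n*m k 2))))) (_ ∣0)
theorem2p7 n@(suc (suc _)) _ =
    (∣⇒∣ᵤ (Φ′′′-doubled n 2≤n) , λ 4∣φ → ∣⇒∣ᵤ (Φ′′′ n 2≤n 4∣φ))
  , λ k 2≤k → ∣⇒∣ᵤ (Φ-odd-derivative n 2≤n k 2≤k)
  where 2≤n = s≤s (s≤s z≤n)
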